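{- Let $\mathsf K$ be a class of conservative residuated lattices defined relative to the variety of idempotent residuated lattices by positive universal formulas in the language $\{\vee,\cdot,\mathrm e\}$. Then the variety $\mathsf V$ generated by $\mathsf K$ has the finite embeddability property.
   Context: A residuated lattice is an algebra $\mathbf A=\langle A,\wedge,\vee,\cdot,\backslash,/,\mathrm e\rangle$ such that $\langle A,\wedge,\vee\rangle$ is a lattice, $\langle A,\cdot,\mathrm e\rangle$ is a monoid, and for all $a,b,c\in A$: $b\le a\backslash c\iff a\cdot b\le c\iff a\le c/b$. It is idempotent if $aa=a$ for all $a$, and conservative if $ab\in\{a,b\}$ for all $a,b\in A$. A positive universal formula is a universally quantified formula built from equations using only conjunction and disjunction (no negation); here the equations are between terms in $\vee,\cdot,\mathrm e$. "$\mathsf K$ is defined relative to the variety of idempotent residuated lattices by a set $\Sigma$ of such formulas" means that $\mathsf K$ is the class of all idempotent residuated lattices satisfying every formula in $\Sigma$ (and all members of $\mathsf K$ are conservative). A variety $\mathsf V$ has the finite embeddability property if for every $\mathbf A\in\mathsf V$ and every finite subset $B\subseteq A$, the partial subalgebra $\mathbf B$ of $\mathbf A$ on $B$ embeds into some finite $\mathbf D\in\mathsf V$, i.e., there is an injective map $h\colon B\to D$ such that for every basic operation $f$ and $b_1,\dots,b_k\in B$ with $f^{\mathbf A}(b_1,\dots,b_k)\in B$, $h(f^{\mathbf A}(b_1,\dots,b_k))=f^{\mathbf D}(h(b_1),\dots,h(b_k))$. -}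

module Defs where

open import Level using (Level; _⊔_; suc; 0ℓ)
open import Algebra.Core using (Op₂)
open import Algebra.Structures using (IsMonoid)
open import Algebra.Lattice.Structures using (IsLattice)
import Algebra.Definitions as AlgebraDefinitions
open import Data.Fin.Base using (Fin)
open import Data.List.Base using (List)
import Data.List.Membership.Setoid as SetoidMembership
open import Data.Nat.Base using (ℕ)
open import Data.Product.Base using (_×_; _,_; ∃; proj₁)
open import Data.Sum.Base using (_⊎_)
open import Function.Bundles using (_⇔_; Injection; Inverse)
open import Relation.Binary.Bundles using (Setoid)
open import Relation.Binary.Core using (Rel)
import Relation.Binary.Construct.NaturalOrder.Left as NaturalOrder
import Relation.Binary.Construct.On as On
import Relation.Binary.PropositionalEquality as ≡
open import Relation.Unary using (Pred; _∈_; _⊆_; _≐_; _∩_)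

-- The order is the lattice order, x ≤ y being x ≈ x ∧ y.  That \\ and //
-- respect ≈ is not a field because it follows from residuation.

record ResiduatedLattice c ℓ : Set (suc (c ⊔ ℓ)) where
  infix  4 _≈_
  infixr 7 _∧_
  infixr 6 _∨_
  infixl 8 _·_
  infixr 8 _\\_
  infixl 8 _//_
  field
    Carrier   : Set c
    _≈_       : Rel Carrier ℓ
    _∧_       : Op₂ Carrier
    _∨_       : Op₂ Carrier
    _·_       : Op₂ Carrier
    _\\_      : Op₂ Carrier
    _//_      : Op₂ Carrier
    e         : Carrier
    isLattice : IsLattice _≈_ _∨_ _∧_
    isMonoid  : IsMonoid _≈_ _·_ e

  open NaturalOrder _≈_ _∧_ public using (_≤_)

  field
    \\-residual : ∀ a b c → (b ≤ (a \\ c)) ⇔ ((a · b) ≤ c)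
    //-residual : ∀ a b c → ((a · b) ≤ c) ⇔ (a ≤ (c // b))

  setoid : Setoid c ℓ
  setoid = record { isEquivalence = IsLattice.isEquivalence isLattice }

Idempotent : ∀ {c ℓ} → Pred (ResiduatedLattice c ℓ) (c ⊔ ℓ)
Idempotent A = AlgebraDefinitions.Idempotent _≈_ _·_
  where open ResiduatedLattice A

Conservative : ∀ {c ℓ} → Pred (ResiduatedLattice c ℓ) (c ⊔ ℓ)
Conservative A = AlgebraDefinitions.Selective _≈_ _·_
  where open ResiduatedLattice A

-- Binary operation symbols of the full language and of its reduct {∨,·,e};
-- the constant e belongs to both and is the constructor `unit` of Term.

data Symbol : Set where
  meet join mult under over : Symbol

data ReductSymbol : Set where
  join mult : ReductSymbol

data Term (F : Set) : Set where
  var  : ℕ → Term F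
  unit : Term F
  app  : F → Term F → Term F → Term F

Equation : Set → Set
Equation F = Term F × Term F

data PositiveFormula : Set where
  equation : Equation ReductSymbol → PositiveFormula
  _and_    : PositiveFormula → PositiveFormula → PositiveFormula
  _or_     : PositiveFormula → PositiveFormula → PositiveFormula

module Semantics {c ℓ} (A : ResiduatedLattice c ℓ) where
  open ResiduatedLattice A

  operation : Symbol → Op₂ Carrier
  operation meet  = _∧_
  operation join  = _∨_
  operation mult  = _·_
  operation under = _\\_
  operation over  = _//_

  reductOperation : ReductSymbol → Op₂ Carrier
  reductOperation join = _∨_
  reductOperation mult = _·_

  eval : {F : Set} → (F → Op₂ Carrier) → (ℕ → Carrier) → Term F → Carrier
  eval I ρ (var i)     = ρ i
  eval I ρ unit        = e
  eval I ρ (app f s t) = I f (eval I ρ s) (eval I ρ t)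

  SatisfiesEquation : Equation Symbol → Set (c ⊔ ℓ)
  SatisfiesEquation (s , t) = ∀ ρ → eval operation ρ s ≈ eval operation ρ t

  Holds : (ℕ → Carrier) → PositiveFormula → Set ℓ
  Holds ρ (equation (s , t)) = eval reductOperation ρ s ≈ eval reductOperation ρ t
  Holds ρ (φ and ψ)          = Holds ρ φ × Holds ρ ψ
  Holds ρ (φ or ψ)           = Holds ρ φ ⊎ Holds ρ ψ

  SatisfiesUniversally : PositiveFormula → Set (c ⊔ ℓ)
  SatisfiesUniversally φ = ∀ ρ → Holds ρ φ

open Semantics public
  using (SatisfiesEquation; SatisfiesUniversally; operation)

PositiveUniversalModels : ∀ {c ℓ p} → Pred PositiveFormula p →
                          Pred (ResiduatedLattice c ℓ) (c ⊔ ℓ ⊔ p)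
PositiveUniversalModels Σ A = ∀ φ → φ ∈ Σ → SatisfiesUniversally A φ

DefinedRelativeToIdempotentBy : ∀ {c ℓ k p} → Pred (ResiduatedLattice c ℓ) k →
                                Pred PositiveFormula p → Set (suc (c ⊔ ℓ) ⊔ k ⊔ p)
DefinedRelativeToIdempotentBy K Σ = K ≐ (Idempotent ∩ PositiveUniversalModels Σ)

EquationalModels : ∀ {c ℓ} → Pred (Equation Symbol) 0ℓ →
                   Pred (ResiduatedLattice c ℓ) (c ⊔ ℓ)
EquationalModels E A = ∀ eq → eq ∈ E → SatisfiesEquation A eq

-- The smallest variety containing K, a variety being the class of all
-- residuated lattices satisfying some set of equations.

VarietyGeneratedBy : ∀ {c ℓ k} → Pred (ResiduatedLattice c ℓ) k →
                     Pred (ResiduatedLattice c ℓ) (suc (c ⊔ ℓ) ⊔ k)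
VarietyGeneratedBy K A =
  ∀ (E : Pred (Equation Symbol) 0ℓ) → K ⊆ EquationalModels E → A ∈ EquationalModels E

Finite : ∀ {c ℓ} → Pred (ResiduatedLattice c ℓ) (c ⊔ ℓ)
Finite A = ∃ λ n → Inverse (ResiduatedLattice.setoid A) (≡.setoid (Fin n))

-- A finite subset is the set of elements occurring, up to ≈, in a list.

module _ {c ℓ} (A : ResiduatedLattice c ℓ) where
  open ResiduatedLattice A
  open SetoidMembership setoid using () renaming (_∈_ to _∈ˡ_)

  subsetoid : List Carrier → Setoid (c ⊔ ℓ) ℓ
  subsetoid B = On.setoid {B = ∃ (_∈ˡ B)} setoid proj₁

record PartialSubalgebraEmbedding
         {c ℓ c′ ℓ′} (A : ResiduatedLattice c ℓ) (B : List (ResiduatedLattice.Carrier A))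
         (D : ResiduatedLattice c′ ℓ′) : Set (c ⊔ ℓ ⊔ c′ ⊔ ℓ′) where
  private
    module A = ResiduatedLattice A
    module D = ResiduatedLattice D
  field
    injection : Injection (subsetoid A B) D.setoid

  h : Setoid.Carrier (subsetoid A B) → D.Carrier
  h = Injection.to injection

  -- x, y, z range over members of B, each paired with its membership proof.
  field
    preserves-operation : ∀ f x y z →
      operation A f (proj₁ x) (proj₁ y) A.≈ proj₁ z →
      operation D f (h x) (h y) D.≈ h z
    preserves-e : ∀ z → A.e A.≈ proj₁ z → D.e D.≈ h z

FiniteEmbeddabilityProperty : ∀ {c ℓ v} → Pred (ResiduatedLattice c ℓ) v →
                              Set (suc (c ⊔ ℓ) ⊔ v)
FiniteEmbeddabilityProperty {c} {ℓ} V =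
  ∀ (A : ResiduatedLattice c ℓ) → A ∈ V → ∀ (B : List (ResiduatedLattice.Carrier A)) →
  ∃ λ (D : ResiduatedLattice c ℓ) → D ∈ V × Finite D × PartialSubalgebraEmbedding A B D

{-# OPTIONS --safe #-}
module Submission where

open import Defs
open import Level using (Level; _⊔_; Lift; lift; lower) renaming (suc to lsuc)
open import Axiom.ExcludedMiddle using (ExcludedMiddle)
open import Relation.Unary using (Pred; _⊆_)

open import Algebra.Core using (Op₂)
open import Algebra.Lattice.Bundles using (Lattice)
import Algebra.Lattice.Properties.Lattice as AlgebraicLattice
open import Algebra.Lattice.Structures using (IsLattice)
open import Algebra.Structures using (IsMonoid)
open import Data.Fin.Base using (Fin; zero; suc)
open import Data.List.Base
  using ( List; []; _∷_; [_]; _++_; map; foldr; length; lookup; allFin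
        ; cartesianProductWith; deduplicate )
open import Data.List.Membership.Propositional using (_∈_; find)
open import Data.List.Membership.Propositional.Properties
  using (∈-map⁺; ∈-map⁻; ∈-allFin; ∈-lookup; ∈-cartesianProductWith⁺)
import Data.List.Membership.Setoid as SetoidMembership
open import Data.List.Membership.Setoid.Properties
  using (∈-resp-≈; ∈-deduplicate⁺) renaming (∈-lookup to ∈ₛ-lookup)
open import Data.List.Properties using (length-map; map-∘; map-cong)
open import Data.List.Relation.Unary.All as All using ()
open import Data.List.Relation.Unary.AllPairs.Core using (_∷_)
open import Data.List.Relation.Unary.Any as Any using (Any; here; there)
import Data.List.Relation.Unary.Any.Properties as Anyₚ
open import Data.List.Relation.Unary.Unique.DecSetoid.Properties using (deduplicate-!)
open import Data.List.Relation.Unary.Unique.Setoid using (Unique)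
open import Data.Nat.Base using (ℕ; zero; suc)
open import Data.Nat.Properties using (suc-injective)
open import Data.Product.Base using (_×_; _,_; ∃; proj₁; proj₂; swap)
open import Data.Sum.Base as Sum using (_⊎_; inj₁; inj₂)
open import Data.Unit.Polymorphic.Base using (⊤)
open import Function.Base using (_∘_; id)
open import Function.Bundles using (_⇔_; mk⇔; Equivalence)
open import Relation.Binary.Bundles using (Setoid; DecSetoid)
open import Relation.Binary.Core using (Rel)
open import Relation.Binary.Definitions using (Reflexive; Transitive)
import Relation.Binary.Lattice as OrderLattice
open import Relation.Binary.Lattice.Definitions using (Supremum; Infimum)
import Relation.Binary.Lattice.Properties.Lattice as OrderLatticeProperties
open import Relation.Binary.PropositionalEquality
  using (_≡_; refl; sym; trans; cong; cong₂; subst; subst₂)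
open import Relation.Nullary.Decidable using (yes; no; True; toWitness; fromWitness; map′)
open import Relation.Nullary.Negation using (¬_; contradiction)

-- Let A be in the variety of K and let s be an element of A that is not above e, hence outside
-- some filter F (an up-set submonoid closed under conjugation, so that A/F makes sense).
-- If φ is valid in K, then K satisfies the equations saying that e is the join of any iterated
-- conjugates of the disjuncts of φ; these pass to A, and they imply that F can be enlarged so as
-- to make φ true in A/F at a given valuation while still avoiding s.  Zorn's lemma is avoided
-- because only finitely many elements matter: given a finite B ⊆ A, choose F maximal with respect
-- to the residuals between the joins of B ∪ {e, m}, where m is a suitable lower bound.  By
-- conservativity these joins form a finite {∨,·,e}-subreduct of A/F with bottom m; its meets and
-- residuals are the largest elements below those of A/F, and it satisfies every formula valid
-- in K, so it is a member of K.  With s = x \\ y it separates x from y, and a finite product over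
-- all pairs x ≰ y in B is the required algebra.

-- Order and residuation laws

module Properties {c ℓ : Level} (A : ResiduatedLattice c ℓ) where
  open ResiduatedLattice A public

  lattice : Lattice c ℓ
  lattice = record { isLattice = isLattice }

  open OrderLattice.IsLattice (AlgebraicLattice.∨-∧-isOrderTheoreticLattice lattice) public
    using (x≤x∨y; y≤x∨y; ∨-least; x∧y≤x; x∧y≤y; ∧-greatest)
    renaming ( refl to ≤-refl; trans to ≤-trans; reflexive to ≤-reflexive; antisym to ≤-antisym
             ; module Eq to ≈ )

  open IsMonoid isMonoid public
    using () renaming (assoc to ·-assoc; identityˡ to ·-identityˡ; identityʳ to ·-identityʳ)

  ≤-reflexive˘ : ∀ {x y} → y ≈ x → x ≤ y
  ≤-reflexive˘ y≈x = ≤-reflexive (≈.sym y≈x)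

  ≤-resp-≈ : ∀ {x y u v} → x ≈ u → y ≈ v → x ≤ y → u ≤ v
  ≤-resp-≈ x≈u y≈v x≤y = ≤-trans (≤-reflexive˘ x≈u) (≤-trans x≤y (≤-reflexive y≈v))

  ∧-mono : ∀ {x y u v} → x ≤ y → u ≤ v → (x ∧ u) ≤ (y ∧ v)
  ∧-mono x≤y u≤v =
    ∧-greatest (≤-trans (x∧y≤x _ _) x≤y) (≤-trans (x∧y≤y _ _) u≤v)

  ∨-mono : ∀ {x y u v} → x ≤ y → u ≤ v → (x ∨ u) ≤ (y ∨ v)
  ∨-mono x≤y u≤v =
    ∨-least (≤-trans x≤y (x≤x∨y _ _)) (≤-trans u≤v (y≤x∨y _ _))

  \\-intro : ∀ {x y z} → (x · y) ≤ z → y ≤ (x \\ z)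
  \\-intro = Equivalence.from (\\-residual _ _ _)

  \\-elim : ∀ {x y z} → y ≤ (x \\ z) → (x · y) ≤ z
  \\-elim = Equivalence.to (\\-residual _ _ _)

  //-intro : ∀ {x y z} → (x · y) ≤ z → x ≤ (z // y)
  //-intro = Equivalence.to (//-residual _ _ _)

  //-elim : ∀ {x y z} → x ≤ (z // y) → (x · y) ≤ z
  //-elim = Equivalence.from (//-residual _ _ _)

  ·-monoˡ : ∀ {x y z} → x ≤ y → (x · z) ≤ (y · z)
  ·-monoˡ x≤y = //-elim (≤-trans x≤y (//-intro ≤-refl))

  ·-monoʳ : ∀ {x y z} → x ≤ y → (z · x) ≤ (z · y)
  ·-monoʳ x≤y = \\-elim (≤-trans x≤y (\\-intro ≤-refl))

  ·-mono : ∀ {x y u v} → x ≤ y → u ≤ v → (x · u) ≤ (y · v)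
  ·-mono x≤y u≤v = ≤-trans (·-monoˡ x≤y) (·-monoʳ u≤v)

  x·[x\\y]≤y : ∀ {x y} → (x · (x \\ y)) ≤ y
  x·[x\\y]≤y = \\-elim ≤-refl

  [y//x]·x≤y : ∀ {x y} → ((y // x) · x) ≤ y
  [y//x]·x≤y = //-elim ≤-refl

  ·-assocˡ : ∀ {x y z} → ((x · y) · z) ≤ (x · (y · z))
  ·-assocˡ = ≤-reflexive (·-assoc _ _ _)

  ·-assocʳ : ∀ {x y z} → (x · (y · z)) ≤ ((x · y) · z)
  ·-assocʳ = ≤-reflexive˘ (·-assoc _ _ _)

  e·x≤x : ∀ {x} → (e · x) ≤ x
  e·x≤x = ≤-reflexive (·-identityˡ _)

  x·e≤x : ∀ {x} → (x · e) ≤ x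
  x·e≤x = ≤-reflexive (·-identityʳ _)

  x≤e·x : ∀ {x} → x ≤ (e · x)
  x≤e·x = ≤-reflexive˘ (·-identityˡ _)

  x≤x·e : ∀ {x} → x ≤ (x · e)
  x≤x·e = ≤-reflexive˘ (·-identityʳ _)

  e≤x\\y⇒x≤y : ∀ {x y} → e ≤ (x \\ y) → x ≤ y
  e≤x\\y⇒x≤y p = ≤-trans x≤x·e (\\-elim p)

  x≤y⇒e≤x\\y : ∀ {x y} → x ≤ y → e ≤ (x \\ y)
  x≤y⇒e≤x\\y p = \\-intro (≤-trans x·e≤x p)

  ·-negativeˡ : ∀ {x y} → x ≤ e → (x · y) ≤ y
  ·-negativeˡ x≤e = ≤-trans (·-monoˡ x≤e) e·x≤x

  ·-negativeʳ : ∀ {x y} → y ≤ e → (x · y) ≤ x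
  ·-negativeʳ y≤e = ≤-trans (·-monoʳ y≤e) x·e≤x

-- A residuated lattice up to the equivalence induced by a preorder.

record ResiduatedPreorder (c ℓ : Level) : Set (lsuc (c ⊔ ℓ)) where
  infix  4 _≲_ _≋_
  infixr 7 _∧_
  infixr 6 _∨_
  infixl 8 _·_
  infixr 8 _\\_
  infixl 8 _//_
  field
    Carrier : Set c
    _≲_     : Rel Carrier ℓ
    _∧_     : Op₂ Carrier
    _∨_     : Op₂ Carrier
    _·_     : Op₂ Carrier
    _\\_    : Op₂ Carrier
    _//_    : Op₂ Carrier
    e       : Carrier
    ≲-refl  : Reflexive _≲_
    ≲-trans : Transitive _≲_

  _≋_ : Rel Carrier ℓ
  x ≋ y = x ≲ y × y ≲ x

  field
    supremum    : Supremum _≲_ _∨_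
    infimum     : Infimum _≲_ _∧_
    ·-assoc     : ∀ x y z → (x · y) · z ≋ x · (y · z)
    ·-identityˡ : ∀ x → e · x ≋ x
    ·-identityʳ : ∀ x → x · e ≋ x
    \\-residual : ∀ a b c → (b ≲ (a \\ c)) ⇔ ((a · b) ≲ c)
    //-residual : ∀ a b c → ((a · b) ≲ c) ⇔ (a ≲ (c // b))

  orderLattice : OrderLattice.Lattice c ℓ ℓ
  orderLattice = record
    { isLattice = record
      { isPartialOrder = record
        { isPreorder = record
          { isEquivalence = record
            { refl  = ≲-refl , ≲-refl
            ; sym   = swap
            ; trans = λ (p , p′) (q , q′) → ≲-trans p q , ≲-trans q′ p′
            }
          ; reflexive = proj₁
          ; trans     = ≲-trans
          }
        ; antisym = _,_
        }
      ; supremum = supremum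
      ; infimum  = infimum
      }
    }

  private
    ≲⇔≤ : ∀ x y → x ≲ y ⇔ x ≋ x ∧ y
    ≲⇔≤ x y = mk⇔
      (λ p → proj₂ (proj₂ (infimum x y)) x ≲-refl p , proj₁ (infimum x y))
      (λ p → ≲-trans (proj₁ p) (proj₁ (proj₂ (infimum x y))))

    module _ {x y : Carrier} where
      open Equivalence (≲⇔≤ x y) public renaming (to to ≲⇒≤; from to ≤⇒≲)

    ·-monoˡ : ∀ {x y z} → x ≲ y → (x · z) ≲ (y · z)
    ·-monoˡ x≲y = Equivalence.from (//-residual _ _ _)
      (≲-trans x≲y (Equivalence.to (//-residual _ _ _) ≲-refl))

    ·-monoʳ : ∀ {x y z} → x ≲ y → (z · x) ≲ (z · y)
    ·-monoʳ x≲y = Equivalence.to (\\-residual _ _ _)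
      (≲-trans x≲y (Equivalence.from (\\-residual _ _ _) ≲-refl))

  residuatedLattice : ResiduatedLattice c ℓ
  residuatedLattice = record
    { Carrier     = Carrier
    ; _≈_         = _≋_
    ; _∧_         = _∧_
    ; _∨_         = _∨_
    ; _·_         = _·_
    ; _\\_        = _\\_
    ; _//_        = _//_
    ; e           = e
    ; isLattice   = OrderLatticeProperties.isAlgLattice orderLattice
    ; isMonoid    = record
      { isSemigroup = record
        { isMagma = record
          { isEquivalence = OrderLattice.Lattice.isEquivalence orderLattice
          ; ∙-cong = λ (p , p′) (q , q′) →
              ≲-trans (·-monoˡ p) (·-monoʳ q) , ≲-trans (·-monoˡ p′) (·-monoʳ q′)
          }
        ; assoc = ·-assoc
        }
      ; identity = ·-identityˡ , ·-identityʳ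
      }
    ; \\-residual = λ a b c → mk⇔
        (≲⇒≤ ∘ Equivalence.to (\\-residual a b c) ∘ ≤⇒≲)
        (≲⇒≤ ∘ Equivalence.from (\\-residual a b c) ∘ ≤⇒≲)
    ; //-residual = λ a b c → mk⇔
        (≲⇒≤ ∘ Equivalence.to (//-residual a b c) ∘ ≤⇒≲)
        (≲⇒≤ ∘ Equivalence.from (//-residual a b c) ∘ ≤⇒≲)
    }

  ≤⇔≲ : ∀ x y → ResiduatedLattice._≤_ residuatedLattice x y ⇔ x ≲ y
  ≤⇔≲ x y = mk⇔ ≤⇒≲ ≲⇒≤

-- Conjugates and filters

data Side : Set where
  left right : Side

module _ {c ℓ : Level} (A : ResiduatedLattice c ℓ) where
  open Properties A

  -- The left and right conjugation maps of residuated lattice theory. The meet with `e` makes every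
  -- value negative, so that multiplying by it is decreasing.
  conjugate : Side → Op₂ Carrier
  conjugate left  a x = (a \\ (x · a)) ∧ e
  conjugate right a x = ((a · x) // a) ∧ e

  iteratedConjugate : List (Side × Carrier) → Carrier → Carrier
  iteratedConjugate []            x = x
  iteratedConjugate ((σ , a) ∷ γ) x = iteratedConjugate γ (conjugate σ a x)

  -- Given by derivations, so that facts about a generated filter are proved by induction. Closure
  -- under meets is derived in `∧-closed`.
  data Filter (xs : List Carrier) : Pred Carrier (c ⊔ ℓ) where
    generator         : ∀ {x} → x ∈ xs → Filter xs x
    e-closed          : Filter xs e
    ≤-closed          : ∀ {x y} → x ≤ y → Filter xs x → Filter xs y
    ·-closed          : ∀ {x y} → Filter xs x → Filter xs y → Filter xs (x · y)
    conjugate-closed  : ∀ {x} σ a → Filter xs x → Filter xs (conjugate σ a x)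

module FilterProperties {c ℓ : Level} (A : ResiduatedLattice c ℓ) where
  open Properties A public

  conjugate-mono : ∀ σ a {x y} → x ≤ y → conjugate A σ a x ≤ conjugate A σ a y
  conjugate-mono left  a x≤y =
    ∧-mono (\\-intro (≤-trans x·[x\\y]≤y (·-monoˡ x≤y))) ≤-refl
  conjugate-mono right a x≤y =
    ∧-mono (//-intro (≤-trans [y//x]·x≤y (·-monoʳ x≤y))) ≤-refl

  conjugate-negative : ∀ σ a x → conjugate A σ a x ≤ e
  conjugate-negative left  a x = x∧y≤y _ _
  conjugate-negative right a x = x∧y≤y _ _

  conjugate-e : ∀ σ a {x} → e ≤ x → e ≤ conjugate A σ a x
  conjugate-e left  a e≤x = ∧-greatest (\\-intro (≤-trans x·e≤x (≤-trans x≤e·x (·-monoˡ e≤x)))) ≤-refl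
  conjugate-e right a e≤x = ∧-greatest (//-intro (≤-trans e·x≤x (≤-trans x≤x·e (·-monoʳ e≤x)))) ≤-refl

  -- What conjugates are for: in place of commutativity, they let a factor pass `a` at the cost of
  -- an inequality.
  left-moves : ∀ a x → (a · conjugate A left a x) ≤ (x · a)
  left-moves a x = \\-elim (x∧y≤x _ _)

  right-moves : ∀ a x → (conjugate A right a x · a) ≤ (a · x)
  right-moves a x = //-elim (x∧y≤x _ _)

  -- The two conjugates pass `a` one after the other, and a product of negative elements is
  -- negative.
  conjugate-· : ∀ σ a x y →
    (conjugate A σ a x · conjugate A σ a y) ≤ conjugate A σ a (x · y)
  conjugate-· left a x y = ∧-greatest
    (\\-intro (≤-trans ·-assocʳ (≤-trans (·-monoˡ (left-moves a x))
      (≤-trans ·-assocˡ (≤-trans (·-monoʳ (left-moves a y)) ·-assocʳ)))))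
    (≤-trans (·-negativeˡ (conjugate-negative left a x)) (conjugate-negative left a y))
  conjugate-· right a x y = ∧-greatest
    (//-intro (≤-trans ·-assocˡ (≤-trans (·-monoʳ (right-moves a y))
      (≤-trans ·-assocʳ (≤-trans (·-monoˡ (right-moves a x)) ·-assocˡ)))))
    (≤-trans (·-negativeˡ (conjugate-negative right a x)) (conjugate-negative right a y))

  iteratedConjugate-mono : ∀ γ {x y} → x ≤ y → iteratedConjugate A γ x ≤ iteratedConjugate A γ y
  iteratedConjugate-mono []            x≤y = x≤y
  iteratedConjugate-mono ((σ , a) ∷ γ) x≤y = iteratedConjugate-mono γ (conjugate-mono σ a x≤y)

  iteratedConjugate-negative : ∀ γ {x} → x ≤ e → iteratedConjugate A γ x ≤ e
  iteratedConjugate-negative []            x≤e = x≤e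
  iteratedConjugate-negative ((σ , a) ∷ γ) x≤e =
    iteratedConjugate-negative γ (conjugate-negative σ a _)

  iteratedConjugate-· : ∀ γ x y →
    (iteratedConjugate A γ x · iteratedConjugate A γ y) ≤ iteratedConjugate A γ (x · y)
  iteratedConjugate-· []            x y = ≤-refl
  iteratedConjugate-· ((σ , a) ∷ γ) x y =
    ≤-trans (iteratedConjugate-· γ _ _) (iteratedConjugate-mono γ (conjugate-· σ a x y))

  iteratedConjugate-closed : ∀ {xs} γ {x} → Filter A xs x → Filter A xs (iteratedConjugate A γ x)
  iteratedConjugate-closed []            f = f
  iteratedConjugate-closed ((σ , a) ∷ γ) f = iteratedConjugate-closed γ (conjugate-closed σ a f)

  -- Conjugation by `e` changes `x` only by meeting it with `e`.
  ∧e-closed : ∀ {xs x} → Filter A xs x → Filter A xs (x ∧ e)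
  ∧e-closed f = ≤-closed
    (∧-mono (≤-trans x≤e·x (≤-trans x·[x\\y]≤y x·e≤x)) ≤-refl)
    (conjugate-closed left e f)

  -- A product of negative elements lies below both factors, so the product of `x ∧ e` and `y ∧ e`
  -- lies below `x ∧ y`.
  ∧-closed : ∀ {xs x y} → Filter A xs x → Filter A xs y → Filter A xs (x ∧ y)
  ∧-closed f g = ≤-closed
    (∧-greatest (≤-trans (·-negativeʳ (x∧y≤y _ _)) (x∧y≤x _ _))
                (≤-trans (·-negativeˡ (x∧y≤y _ _)) (x∧y≤x _ _)))
    (·-closed (∧e-closed f) (∧e-closed g))

  weaken : ∀ {xs x} → Filter A xs ⊆ Filter A (x ∷ xs)
  weaken (generator x∈xs)         = generator (there x∈xs)
  weaken e-closed                 = e-closed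
  weaken (≤-closed x≤y f)         = ≤-closed x≤y (weaken f)
  weaken (·-closed f g)           = ·-closed (weaken f) (weaken g)
  weaken (conjugate-closed σ a f) = conjugate-closed σ a (weaken f)

  -- The up-set of `e` already has all the closure properties. This filter is the starting point for
  -- extensions that avoid `s`.
  Filter[]⇒e≤ : ∀ {x} → Filter A [] x → e ≤ x
  Filter[]⇒e≤ e-closed                 = ≤-refl
  Filter[]⇒e≤ (≤-closed x≤y f)         = ≤-trans (Filter[]⇒e≤ f) x≤y
  Filter[]⇒e≤ (·-closed f g)           =
    ≤-trans x≤e·x (·-mono (Filter[]⇒e≤ f) (Filter[]⇒e≤ g))
  Filter[]⇒e≤ (conjugate-closed σ a f) = conjugate-e σ a (Filter[]⇒e≤ f)

  module _ {xs : List Carrier} {t z : Carrier} (z≤e : z ≤ e)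
           (joins : ∀ γ → Filter A xs (z ∨ iteratedConjugate A γ (t ∧ e))) where

    -- Induction on the derivation of `s`. All `γ` are treated at once because the case of a
    -- conjugate prepends one more conjugation to `γ`.
    ∨-absorbs : ∀ {s} → Filter A (t ∷ xs) s → ∀ γ → Filter A xs (z ∨ iteratedConjugate A γ (s ∧ e))
    ∨-absorbs (generator (here refl))  γ = joins γ
    ∨-absorbs (generator (there x∈xs)) γ =
      ≤-closed (y≤x∨y _ _) (iteratedConjugate-closed γ (∧e-closed (generator x∈xs)))
    ∨-absorbs e-closed γ =
      ≤-closed (y≤x∨y _ _) (iteratedConjugate-closed γ (∧e-closed e-closed))
    ∨-absorbs (≤-closed x≤y f) γ =
      ≤-closed (∨-mono ≤-refl (iteratedConjugate-mono γ (∧-mono x≤y ≤-refl))) (∨-absorbs f γ)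
    ∨-absorbs (·-closed {x} {y} f g) γ =
      ≤-closed distribute (·-closed (∨-absorbs f γ) (∨-absorbs g γ))
      where
      u = iteratedConjugate A γ (x ∧ e)
      v = iteratedConjugate A γ (y ∧ e)
      u·v≤ : (u · v) ≤ iteratedConjugate A γ ((x · y) ∧ e)
      u·v≤ = ≤-trans (iteratedConjugate-· γ _ _) (iteratedConjugate-mono γ
        (∧-greatest (·-mono (x∧y≤x _ _) (x∧y≤x _ _))
                    (≤-trans (·-negativeˡ (x∧y≤y _ _)) (x∧y≤y _ _))))
      u≤e : u ≤ e
      u≤e = iteratedConjugate-negative γ (x∧y≤y _ _)
      v≤e : v ≤ e
      v≤e = iteratedConjugate-negative γ (x∧y≤y _ _)
      distribute : ((z ∨ u) · (z ∨ v)) ≤ (z ∨ iteratedConjugate A γ ((x · y) ∧ e))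
      -- When the product is expanded, every summand except `u · v` has a factor `z` and a negative
      -- other factor, hence lies below `z`.
      distribute = //-elim (∨-least
        (//-intro (≤-trans (·-negativeʳ (∨-least z≤e v≤e)) (x≤x∨y _ _)))
        (//-intro (\\-elim (∨-least
          (\\-intro (≤-trans (·-negativeˡ u≤e) (x≤x∨y _ _)))
          (\\-intro (≤-trans u·v≤ (y≤x∨y _ _)))))))
    ∨-absorbs (conjugate-closed {x} σ a f) γ =
      ≤-closed (∨-mono ≤-refl (iteratedConjugate-mono γ
                 (∧-greatest (conjugate-mono σ a (x∧y≤x _ _)) (conjugate-negative σ a _))))
               (∨-absorbs f ((σ , a) ∷ γ))

  -- The argument `z` accumulates the join, to which each entry contributes one arbitrarily chosen
  -- iterated conjugate of its negative part.
  JoinsIn : List Carrier → Carrier → List Carrier → Set (c ⊔ ℓ)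
  JoinsIn xs z []       = Filter A xs z
  JoinsIn xs z (t ∷ ts) = ∀ γ → JoinsIn xs (z ∨ iteratedConjugate A γ (t ∧ e)) ts

  -- Induction on the list. For each `γ`, the rest of the list is handled with the conjugate of `t`
  -- put into the accumulator; then `∨-absorbs`, applied with `z ∨ (s ∧ e)` in the role of `z`,
  -- trades `t` for `s`.
  JoinsIn⇒∨∈Filter : ∀ {xs s} z ts → z ≤ e → JoinsIn xs z ts →
    (∀ {t} → t ∈ ts → Filter A (t ∷ xs) s) → Filter A xs (z ∨ (s ∧ e))
  JoinsIn⇒∨∈Filter z []       z≤e f s∈ = ≤-closed (x≤x∨y _ _) f
  JoinsIn⇒∨∈Filter z (t ∷ ts) z≤e f s∈ = ≤-closed (∨-least ≤-refl (y≤x∨y _ _))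
    (∨-absorbs (∨-least z≤e (x∧y≤y _ _))
      (λ γ → ≤-closed
        (∨-least (∨-mono (x≤x∨y _ _) ≤-refl) (≤-trans (y≤x∨y _ _) (x≤x∨y _ _)))
        (JoinsIn⇒∨∈Filter _ ts
          (∨-least z≤e (iteratedConjugate-negative γ (x∧y≤y _ _))) (f γ) (s∈ ∘ there)))
      (s∈ (here refl)) [])

-- Terms

value : ∀ {c ℓ} (A : ResiduatedLattice c ℓ) → (ℕ → ResiduatedLattice.Carrier A) →
        Term Symbol → ResiduatedLattice.Carrier A
value A = Semantics.eval A (operation A)

reductValue : ∀ {c ℓ} (A : ResiduatedLattice c ℓ) → (ℕ → ResiduatedLattice.Carrier A) →
              Term ReductSymbol → ResiduatedLattice.Carrier A
reductValue A = Semantics.eval A (Semantics.reductOperation A)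

shift : ∀ {F} → Term F → Term F
shift (var i)     = var (suc i)
shift unit        = unit
shift (app f s t) = app f (shift s) (shift t)

infixr 5 _◂_

_◂_ : ∀ {a} {X : Set a} → X → (ℕ → X) → ℕ → X
(x ◂ ρ) zero    = x
(x ◂ ρ) (suc i) = ρ i

-- Shifting `t` frees variable 0, which stands for the conjugating element. Conjugation by an
-- arbitrary element thus becomes expressible in equations.
conjugateTerm : Side → Term Symbol → Term Symbol
conjugateTerm left  t = app meet (app under (var 0) (app mult (shift t) (var 0))) unit
conjugateTerm right t = app meet (app over (app mult (var 0) (shift t)) (var 0)) unit

inclusion : Term ReductSymbol → Term Symbol
inclusion (var i)        = var i
inclusion unit           = unit
inclusion (app join s t) = app join (inclusion s) (inclusion t)
inclusion (app mult s t) = app mult (inclusion s) (inclusion t)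

-- φ holds exactly if e lies below one of these terms, which are the disjuncts of
-- a disjunctive normal form of φ.

disjuncts : PositiveFormula → List (Term Symbol)
disjuncts (equation (s , t)) =
  [ app meet (app under (inclusion s) (inclusion t)) (app under (inclusion t) (inclusion s)) ]
disjuncts (φ and ψ) = cartesianProductWith (app meet) (disjuncts φ) (disjuncts ψ)
disjuncts (φ or ψ)  = disjuncts φ ++ disjuncts ψ

module TermProperties {c ℓ : Level} (A : ResiduatedLattice c ℓ) where
  open FilterProperties A

  value-shift : ∀ ρ t → value A ρ (shift t) ≡ value A (ρ ∘ suc) t
  value-shift ρ (var i)     = refl
  value-shift ρ unit        = refl
  value-shift ρ (app f s t) = cong₂ (operation A f) (value-shift ρ s) (value-shift ρ t)

  value-conjugateTerm : ∀ σ ρ t →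
    value A ρ (conjugateTerm σ t) ≡ conjugate A σ (ρ 0) (value A (ρ ∘ suc) t)
  value-conjugateTerm left  ρ t = cong (conjugate A left (ρ 0)) (value-shift ρ t)
  value-conjugateTerm right ρ t = cong (conjugate A right (ρ 0)) (value-shift ρ t)

  value-inclusion : ∀ ρ t → value A ρ (inclusion t) ≡ reductValue A ρ t
  value-inclusion ρ (var i)        = refl
  value-inclusion ρ unit           = refl
  value-inclusion ρ (app join s t) = cong₂ _∨_ (value-inclusion ρ s) (value-inclusion ρ t)
  value-inclusion ρ (app mult s t) = cong₂ _·_ (value-inclusion ρ s) (value-inclusion ρ t)

  SomeAbove : (ℕ → Carrier) → List (Term Symbol) → Set ℓ
  SomeAbove ρ = Any (λ t → e ≤ value A ρ t)

  SomeAbove-shift : ∀ ρ {ts} → SomeAbove (ρ ∘ suc) ts → SomeAbove ρ (map shift ts)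
  SomeAbove-shift ρ = Anyₚ.map⁺ ∘ Any.map (λ {t} → subst (e ≤_) (sym (value-shift ρ t)))

  -- An equation is a pair of inequalities, each saying that `e` lies below a residual. Conjunctions
  -- become meets, because `e` lies below a meet exactly if it lies below both parts.
  holds⇒disjunct : ∀ ρ φ → Semantics.Holds A ρ φ → SomeAbove ρ (disjuncts φ)
  holds⇒disjunct ρ (equation (s , t)) s≈t = here (∧-greatest
    (subst₂ (λ x y → e ≤ (x \\ y)) (sym (value-inclusion ρ s)) (sym (value-inclusion ρ t))
      (x≤y⇒e≤x\\y (≤-reflexive s≈t)))
    (subst₂ (λ x y → e ≤ (x \\ y)) (sym (value-inclusion ρ t)) (sym (value-inclusion ρ s))
      (x≤y⇒e≤x\\y (≤-reflexive˘ s≈t))))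
  holds⇒disjunct ρ (φ and ψ) (p , q) =
    Anyₚ.cartesianProductWith⁺ (app meet) ∧-greatest (holds⇒disjunct ρ φ p) (holds⇒disjunct ρ ψ q)
  holds⇒disjunct ρ (φ or ψ) (inj₁ p) = Anyₚ.++⁺ˡ (holds⇒disjunct ρ φ p)
  holds⇒disjunct ρ (φ or ψ) (inj₂ q) = Anyₚ.++⁺ʳ (disjuncts φ) (holds⇒disjunct ρ ψ q)

  disjunct⇒holds : ∀ ρ φ → SomeAbove ρ (disjuncts φ) → Semantics.Holds A ρ φ
  disjunct⇒holds ρ (equation (s , t)) (here p) = ≤-antisym
    (e≤x\\y⇒x≤y (subst₂ (λ x y → e ≤ (x \\ y)) (value-inclusion ρ s) (value-inclusion ρ t)
      (≤-trans p (x∧y≤x _ _))))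
    (e≤x\\y⇒x≤y (subst₂ (λ x y → e ≤ (x \\ y)) (value-inclusion ρ t) (value-inclusion ρ s)
      (≤-trans p (x∧y≤y _ _))))
  disjunct⇒holds ρ (φ and ψ) p =
    let p₁ , p₂ = Anyₚ.cartesianProductWith⁻ (app meet)
                    (λ q → ≤-trans q (x∧y≤x _ _) , ≤-trans q (x∧y≤y _ _))
                    (disjuncts φ) (disjuncts ψ) p
    in disjunct⇒holds ρ φ p₁ , disjunct⇒holds ρ ψ p₂
  disjunct⇒holds ρ (φ or ψ) p =
    Sum.map (disjunct⇒holds ρ φ) (disjunct⇒holds ρ ψ) (Anyₚ.++⁻ (disjuncts φ) p)

ValidIn : ∀ {c ℓ k} → Pred (ResiduatedLattice c ℓ) k → PositiveFormula → Set (lsuc (c ⊔ ℓ) ⊔ k)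
ValidIn K φ = ∀ {C} → K C → SatisfiesUniversally C φ

-- The equations z ∨ γ₁(t₁) ∨ … ∨ γₙ(tₙ) = e, for all iterated conjugates γᵢ, hold in K
-- whenever z or one of the tᵢ is always above e; being equations, they pass to the variety.

module Primeness {c ℓ k : Level} (K : Pred (ResiduatedLattice c ℓ) k)
                 (A : ResiduatedLattice c ℓ) (A∈V : VarietyGeneratedBy K A) where
  open FilterProperties A

  ValidDisjunction : Term Symbol → List (Term Symbol) → Set (lsuc (c ⊔ ℓ) ⊔ k)
  ValidDisjunction z ts = ∀ {C} → K C → ∀ ρ →
    Properties._≤_ C (Properties.e C) (value C ρ z) ⊎ TermProperties.SomeAbove C ρ ts

  -- By the definition of the order, `e ≤ z` is itself the equation `e ≈ e ∧ z`, and the set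
  -- consisting of this one equation is used to pass from `K` to `A`.
  above-e : ∀ {z} → (∀ {C} → K C → ∀ ρ → Properties._≤_ C (Properties.e C) (value C ρ z)) →
            ∀ ρ → e ≤ value A ρ z
  above-e {z} above = A∈V (_≡ (unit , app meet unit z)) (λ { {C} C∈K _ refl ρ → above C∈K ρ }) _ refl

  mutual

    -- The length `n` is the termination measure: the remaining terms get shifted on the way, so the
    -- list does not shrink structurally.
    joinsIn : ∀ {xs} n z ts → length ts ≡ n → ValidDisjunction z ts →
              ∀ ρ → JoinsIn xs (value A ρ z) (map (value A ρ) ts)
    joinsIn zero z [] _ valid ρ =
      ≤-closed (above-e {z} (λ C∈K ρ → Sum.[ id , (λ ()) ]′ (valid C∈K ρ)) ρ) e-closed
    joinsIn (suc n) z (t ∷ ts) eq valid ρ γ =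
      joinsIn′ n z (app meet t unit) ts (suc-injective eq) γ
        (λ {C} C∈K ρ → Sum.map id
          (λ { (here p)  → here (Properties.∧-greatest C p (Properties.≤-refl C))
             ; (there p) → there p })
          (valid C∈K ρ))
        ρ

    -- Induction on `γ`: each conjugating element becomes the value of a fresh variable, and the
    -- disjunction stays valid in `K` since conjugates of elements above `e` are above `e`. Once `γ`
    -- is used up, `u` joins the accumulator.
    joinsIn′ : ∀ {xs} n z u ts → length ts ≡ n → ∀ γ → ValidDisjunction z (u ∷ ts) →
               ∀ ρ → JoinsIn xs (value A ρ z ∨ iteratedConjugate A γ (value A ρ u))
                               (map (value A ρ) ts)
    joinsIn′ n z u ts eq [] valid ρ = joinsIn n (app join z u) ts eq
      (λ {C} C∈K ρ → Sum.[ (λ p → inj₁ (Properties.≤-trans C p (Properties.x≤x∨y C _ _)))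
                         , (λ { (here p)  → inj₁ (Properties.≤-trans C p (Properties.y≤x∨y C _ _))
                              ; (there p) → inj₂ p }) ]′ (valid C∈K ρ))
      ρ
    joinsIn′ {xs} n z u ts eq ((σ , a) ∷ γ) valid ρ =
      subst₂ (JoinsIn xs)
        (cong₂ (λ x y → x ∨ iteratedConjugate A γ y)
          (value-shift (a ◂ ρ) z) (value-conjugateTerm σ (a ◂ ρ) u))
        (trans (sym (map-∘ ts)) (map-cong (value-shift (a ◂ ρ)) ts))
        (joinsIn′ n (shift z) (conjugateTerm σ u) (map shift ts) (trans (length-map shift ts) eq) γ
          valid′ (a ◂ ρ))
      where
      open TermProperties A using (value-shift; value-conjugateTerm)
      valid′ : ValidDisjunction (shift z) (conjugateTerm σ u ∷ map shift ts)
      valid′ {C} C∈K ρ with valid C∈K (ρ ∘ suc)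
      ... | inj₁ p = inj₁ (subst (Properties._≤_ C (Properties.e C))
                       (sym (TermProperties.value-shift C ρ z)) p)
      ... | inj₂ (here p) = inj₂ (here (subst (Properties._≤_ C (Properties.e C))
                              (sym (TermProperties.value-conjugateTerm C σ ρ u))
                              (FilterProperties.conjugate-e C σ (ρ 0) p)))
      ... | inj₂ (there p) = inj₂ (there (TermProperties.SomeAbove-shift C ρ p))

  -- The element s enters the disjunction as the value of a fresh variable.
  filter-prime : ∀ {xs s} φ → ValidIn K φ → ∀ ρ →
    (∀ {t} → t ∈ map (value A ρ) (disjuncts φ) → Filter A (t ∷ xs) s) → Filter A xs s
  filter-prime {xs} {s} φ valid ρ s∈ =
    ≤-closed (∨-least (x∧y≤x _ _) (x∧y≤x _ _))
      (JoinsIn⇒∨∈Filter (s ∧ e) (map (value A ρ) (disjuncts φ)) (x∧y≤y _ _)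
        (subst (JoinsIn xs (s ∧ e))
          (trans (sym (map-∘ (disjuncts φ))) (map-cong (TermProperties.value-shift A (s ◂ ρ)) (disjuncts φ)))
          (joinsIn _ (app meet (var 0) unit) (map shift (disjuncts φ)) refl
            (λ {C} C∈K ρ → inj₂ (TermProperties.SomeAbove-shift C ρ
              (TermProperties.holds⇒disjunct C (ρ ∘ suc) φ (valid C∈K (ρ ∘ suc)))))
            (s ◂ ρ)))
        s∈)

-- The quotient by a filter

module Quotient {c ℓ : Level} (em : ExcludedMiddle (c ⊔ ℓ)) (A : ResiduatedLattice c ℓ)
                (xs : List (ResiduatedLattice.Carrier A)) where
  open FilterProperties A

  -- Membership in the filter lives in c ⊔ ℓ; excluded middle resizes it to the level ℓ of ≈.
  _≲_ : Rel Carrier ℓ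
  x ≲ y = Lift ℓ (True (em {Filter A xs (x \\ y)}))

  ≲⇒Filter : ∀ {x y} → x ≲ y → Filter A xs (x \\ y)
  ≲⇒Filter p = toWitness (lower p)

  Filter⇒≲ : ∀ {x y} → Filter A xs (x \\ y) → x ≲ y
  Filter⇒≲ f = lift (fromWitness f)

  ≤⇒≲ : ∀ {x y} → x ≤ y → x ≲ y
  ≤⇒≲ x≤y = Filter⇒≲ (≤-closed (x≤y⇒e≤x\\y x≤y) e-closed)

  private
    -- Reduces the laws of the quotient to finding a filter element `f` that multiplies `x` on the
    -- right to something below `y`.
    multiplier : ∀ {x y f} → (x · f) ≤ y → Filter A xs f → x ≲ y
    multiplier x·f≤y f = Filter⇒≲ (≤-closed (\\-intro x·f≤y) f)

    greatest : ∀ {x y z} → z ≲ x → z ≲ y → z ≲ (x ∧ y)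
    greatest p q = multiplier
      (∧-greatest (\\-elim (x∧y≤x _ _)) (\\-elim (x∧y≤y _ _)))
      (∧-closed (≲⇒Filter p) (≲⇒Filter q))

    least : ∀ {x y z} → x ≲ z → y ≲ z → (x ∨ y) ≲ z
    least p q = multiplier
      (//-elim (∨-least (//-intro (\\-elim (x∧y≤x _ _))) (//-intro (\\-elim (x∧y≤y _ _)))))
      (∧-closed (≲⇒Filter p) (≲⇒Filter q))

  residuatedPreorder : ResiduatedPreorder c ℓ
  residuatedPreorder = record
    { Carrier     = Carrier
    ; _≲_         = _≲_
    ; _∧_         = _∧_
    ; _∨_         = _∨_
    ; _·_         = _·_
    ; _\\_        = _\\_
    ; _//_        = _//_
    ; e           = e
    ; ≲-refl      = ≤⇒≲ ≤-refl
    ; ≲-trans     = λ p q → multiplier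
        (≤-trans ·-assocʳ (≤-trans (·-monoˡ x·[x\\y]≤y) x·[x\\y]≤y))
        (·-closed (≲⇒Filter p) (≲⇒Filter q))
    ; supremum    = λ x y → ≤⇒≲ (x≤x∨y x y) , ≤⇒≲ (y≤x∨y x y) , λ _ → least
    ; infimum     = λ x y → ≤⇒≲ (x∧y≤x x y) , ≤⇒≲ (x∧y≤y x y) , λ _ → greatest
    ; ·-assoc     = λ x y z → ≤⇒≲ ·-assocˡ , ≤⇒≲ ·-assocʳ
    ; ·-identityˡ = λ x → ≤⇒≲ e·x≤x , ≤⇒≲ x≤e·x
    ; ·-identityʳ = λ x → ≤⇒≲ x·e≤x , ≤⇒≲ x≤x·e
    ; \\-residual = λ a b d → mk⇔
        (λ p → multiplier (≤-trans ·-assocˡ (\\-elim x·[x\\y]≤y)) (≲⇒Filter p))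
        (λ p → multiplier (\\-intro (≤-trans ·-assocʳ x·[x\\y]≤y)) (≲⇒Filter p))
    -- The multiplier has to pass `b`, to its left in one direction and to its right in the other,
    -- so a conjugate by `b` takes its place.
    ; //-residual = λ a b d → mk⇔
        (λ p → multiplier
          (//-intro (≤-trans ·-assocˡ (≤-trans (·-monoʳ (right-moves b _))
            (≤-trans ·-assocʳ x·[x\\y]≤y))))
          (conjugate-closed right b (≲⇒Filter p)))
        (λ p → multiplier
          (≤-trans ·-assocˡ (≤-trans (·-monoʳ (left-moves b _))
            (≤-trans ·-assocʳ (//-elim x·[x\\y]≤y))))
          (conjugate-closed left b (≲⇒Filter p)))
    }

  algebra : ResiduatedLattice c ℓ
  algebra = ResiduatedPreorder.residuatedLattice residuatedPreorder

  ≲⇒≤ : ∀ {x y} → x ≲ y → ResiduatedLattice._≤_ algebra x y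
  ≲⇒≤ = Equivalence.from (ResiduatedPreorder.≤⇔≲ residuatedPreorder _ _)

  ≤/⇒≲ : ∀ {x y} → ResiduatedLattice._≤_ algebra x y → x ≲ y
  ≤/⇒≲ = Equivalence.to (ResiduatedPreorder.≤⇔≲ residuatedPreorder _ _)

  ≤⇒≤/ : ∀ {x y} → x ≤ y → ResiduatedLattice._≤_ algebra x y
  ≤⇒≤/ = ≲⇒≤ ∘ ≤⇒≲

  ≈⇒≈/ : ∀ {x y} → x ≈ y → ResiduatedLattice._≈_ algebra x y
  ≈⇒≈/ x≈y = ≤⇒≲ (≤-reflexive x≈y) , ≤⇒≲ (≤-reflexive˘ x≈y)

  -- The quotient keeps the carrier and the operations and coarsens only `≈`, so values agree on the
  -- nose.
  value-quotient : ∀ ρ t → value algebra ρ t ≡ value A ρ t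
  value-quotient ρ (var i)         = refl
  value-quotient ρ unit            = refl
  value-quotient ρ (app meet s t)  = cong₂ _∧_ (value-quotient ρ s) (value-quotient ρ t)
  value-quotient ρ (app join s t)  = cong₂ _∨_ (value-quotient ρ s) (value-quotient ρ t)
  value-quotient ρ (app mult s t)  = cong₂ _·_ (value-quotient ρ s) (value-quotient ρ t)
  value-quotient ρ (app under s t) = cong₂ _\\_ (value-quotient ρ s) (value-quotient ρ t)
  value-quotient ρ (app over s t)  = cong₂ _//_ (value-quotient ρ s) (value-quotient ρ t)

  reductValue-quotient : ∀ ρ t → reductValue algebra ρ t ≡ reductValue A ρ t
  reductValue-quotient ρ (var i)        = refl
  reductValue-quotient ρ unit           = refl
  reductValue-quotient ρ (app join s t) =
    cong₂ _∨_ (reductValue-quotient ρ s) (reductValue-quotient ρ t)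
  reductValue-quotient ρ (app mult s t) =
    cong₂ _·_ (reductValue-quotient ρ s) (reductValue-quotient ρ t)

  e≤/filter : ∀ {x} → Filter A xs x → ResiduatedLattice._≤_ algebra e x
  e≤/filter f = ≲⇒≤ (multiplier e·x≤x f)

-- Filters avoiding an element, maximal for finitely many tests

module Saturation {c ℓ k : Level} (em : ExcludedMiddle (c ⊔ ℓ))
                  (K : Pred (ResiduatedLattice c ℓ) k)
                  (A : ResiduatedLattice c ℓ) (A∈V : VarietyGeneratedBy K A)
                  (s : ResiduatedLattice.Carrier A) where
  open FilterProperties A
  open Quotient em A using (algebra)

  infix 4 _⊑_

  _⊑_ : Rel (List Carrier) (c ⊔ ℓ)
  xs ⊑ ys = (∀ x → Filter A xs x → Filter A ys x) × ¬ Filter A ys s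

  ⊑-trans : ∀ {xs ys zs} → xs ⊑ ys → ys ⊑ zs → xs ⊑ zs
  ⊑-trans (p , _) (q , s∉) = (λ x → q x ∘ p x) , s∉

  -- Maximality among the filters avoiding `s`, tested at the single element `u`.
  Saturated : List Carrier → Carrier → Set (c ⊔ ℓ)
  Saturated xs u = ∀ {ys} → xs ⊑ ys → Filter A ys u → Filter A xs u

  -- Each `u` is settled once: either some extension avoiding `s` contains it, and the construction
  -- moves there, or none does. Further extension preserves both outcomes.
  saturate : ∀ us {xs} → ¬ Filter A xs s → ∃ λ ys → xs ⊑ ys × (∀ {u} → u ∈ us → Saturated ys u)
  saturate [] {xs} s∉ = xs , ((λ _ → id) , s∉) , λ ()
  saturate (u ∷ us) {xs} s∉ with em {∃ λ ys → xs ⊑ ys × Filter A ys u}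
  ... | yes (ys , xs⊑ys , u∈) with saturate us (proj₂ xs⊑ys)
  ...   | zs , ys⊑zs , sat = zs , ⊑-trans xs⊑ys ys⊑zs , λ where
            (here refl) _ _ → proj₁ ys⊑zs u u∈
            (there u′∈)     → sat u′∈
  saturate (u ∷ us) {xs} s∉ | no u∉ with saturate us s∉
  ...   | zs , xs⊑zs , sat = zs , xs⊑zs , λ where
            (here refl) zs⊑ws u∈ → contradiction (_ , ⊑-trans xs⊑zs zs⊑ws , u∈) u∉
            (there u′∈)          → sat u′∈

  -- If adding any disjunct forced `s` into the filter, primeness would put `s` there already. So
  -- some disjunct can be added, and it makes `φ` true in the quotient.
  realize : ∀ φ → ValidIn K φ → ∀ ρ {xs} → ¬ Filter A xs s →
            ∃ λ ys → xs ⊑ ys × Semantics.Holds (algebra ys) ρ φ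
  realize φ valid ρ {xs} s∉ with em {∃ λ t → t ∈ disjuncts φ × ¬ Filter A (value A ρ t ∷ xs) s}
  ... | yes (t , t∈ , s∉′) = value A ρ t ∷ xs , ((λ _ → weaken) , s∉′) ,
        TermProperties.disjunct⇒holds (algebra _) ρ φ (Any.map (λ where
          refl → Quotient.e≤/filter em A _ (subst (Filter A _)
                   (sym (Quotient.value-quotient em A _ ρ t)) (generator (here refl)))) t∈)
  ... | no ¬∃ = contradiction (Primeness.filter-prime K A A∈V φ valid ρ s∈) s∉
    where
    s∈ : ∀ {u} → u ∈ map (value A ρ) (disjuncts φ) → Filter A (u ∷ xs) s
    s∈ u∈ with ∈-map⁻ (value A ρ) u∈
    ... | t , t∈ , refl with em {Filter A (value A ρ t ∷ xs) s}
    ...   | yes s∈ = s∈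
    ...   | no s∉′ = contradiction (t , t∈ , s∉′) ¬∃

-- Congruence of the operations and transfer of formulas

module _ {c ℓ : Level} (A : ResiduatedLattice c ℓ) where
  open Properties A

  private
    \\-mono : ∀ {x y u v} → y ≤ x → u ≤ v → (x \\ u) ≤ (y \\ v)
    \\-mono y≤x u≤v = \\-intro (≤-trans (·-monoˡ y≤x) (≤-trans x·[x\\y]≤y u≤v))

    //-mono : ∀ {x y u v} → x ≤ y → v ≤ u → (x // u) ≤ (y // v)
    //-mono x≤y v≤u = //-intro (≤-trans (·-monoʳ v≤u) (≤-trans [y//x]·x≤y x≤y))

  operation-cong : ∀ f {x y u v} → x ≈ y → u ≈ v → operation A f x u ≈ operation A f y v
  operation-cong meet  p q = IsLattice.∧-cong isLattice p q
  operation-cong join  p q = IsLattice.∨-cong isLattice p q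
  operation-cong mult  p q = IsMonoid.∙-cong isMonoid p q
  operation-cong under p q = ≤-antisym (\\-mono (≤-reflexive˘ p) (≤-reflexive q))
                                       (\\-mono (≤-reflexive p) (≤-reflexive˘ q))
  operation-cong over  p q = ≤-antisym (//-mono (≤-reflexive p) (≤-reflexive˘ q))
                                       (//-mono (≤-reflexive˘ p) (≤-reflexive q))

-- This is where positivity enters: conjunction and disjunction are monotone, so a one-way transfer
-- of equations carries the whole formula.
Holds-map : ∀ {c ℓ c′ ℓ′} (A : ResiduatedLattice c ℓ) (D : ResiduatedLattice c′ ℓ′) ρ τ →
  (∀ s t → ResiduatedLattice._≈_ A (reductValue A ρ s) (reductValue A ρ t) →
           ResiduatedLattice._≈_ D (reductValue D τ s) (reductValue D τ t)) →
  ∀ φ → Semantics.Holds A ρ φ → Semantics.Holds D τ φ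
Holds-map A D ρ τ f (equation (s , t)) p       = f s t p
Holds-map A D ρ τ f (φ and ψ)          (p , q) = Holds-map A D ρ τ f φ p , Holds-map A D ρ τ f ψ q
Holds-map A D ρ τ f (φ or ψ)                   =
  Sum.map (Holds-map A D ρ τ f φ) (Holds-map A D ρ τ f ψ)

-- Finite subalgebras of the {∨,·,e}-reduct

resize : ∀ {a} b → ExcludedMiddle (a ⊔ b) → ExcludedMiddle a
resize b em {P} = map′ lower lift (em {Lift b P})

record FiniteReduct {c ℓ : Level} (C : ResiduatedLattice c ℓ) : Set (c ⊔ ℓ) where
  open Properties C
  field
    size    : ℕ
    element : Fin size → Carrier

  Image : Carrier → Set ℓ
  Image x = ∃ λ i → element i ≈ x

  field
    ∨-image   : ∀ i j → Image (element i ∨ element j)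
    ·-image   : ∀ i j → Image (element i · element j)
    e-image   : Image e
    bottom    : Fin size
    bottom-∧  : ∀ i j → element bottom ≤ (element i ∧ element j)
    bottom-\\ : ∀ i j → element bottom ≤ (element i \\ element j)
    bottom-// : ∀ i j → element bottom ≤ (element i // element j)

-- Meets and residuals are the largest elements of the reduct below those of C.

module Truncation {c ℓ : Level} (em : ExcludedMiddle ℓ)
                  (C : ResiduatedLattice c ℓ) (S : FiniteReduct C) where
  open Properties C
  open FiniteReduct S

  private
    -- The witness is the join of `bottom` and all listed elements below `w`; it stays below `w`,
    -- and the reduct is closed under joins.
    floorOf : ∀ w → element bottom ≤ w → (is : List (Fin size)) →
              ∃ λ k → element k ≤ w × (∀ {j} → j ∈ is → element j ≤ w → element j ≤ element k)
    floorOf w ⊥≤w []       = bottom , ⊥≤w , λ ()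
    floorOf w ⊥≤w (i ∷ is) with floorOf w ⊥≤w is | em {element i ≤ w}
    ... | k , k≤w , max | no i≰w = k , k≤w , λ where
          (here refl) i≤w → contradiction i≤w i≰w
          (there j∈)      → max j∈
    ... | k , k≤w , max | yes i≤w with ∨-image i k
    ...   | l , l≈ = l , ≤-trans (≤-reflexive l≈) (∨-least i≤w k≤w) , λ where
          (here refl) _  → ≤-trans (x≤x∨y _ _) (≤-reflexive˘ l≈)
          (there j∈) j≤w → ≤-trans (max j∈ j≤w) (≤-trans (y≤x∨y _ _) (≤-reflexive˘ l≈))

  module Floor (w : Carrier) (⊥≤w : element bottom ≤ w) where
    floor : Fin size
    floor = proj₁ (floorOf w ⊥≤w (allFin size))

    floor≤ : element floor ≤ w
    floor≤ = proj₁ (proj₂ (floorOf w ⊥≤w (allFin size)))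

    floor-greatest : ∀ {j} → element j ≤ w → element j ≤ element floor
    floor-greatest = proj₂ (proj₂ (floorOf w ⊥≤w (allFin size))) (∈-allFin _)

    -- Ensures that a meet or residual of `C` lying in the reduct survives the truncation, as
    -- partial embeddings demand.
    floor-exact : ∀ {k} → w ≈ element k →
                  element floor ≤ element k × element k ≤ element floor
    floor-exact w≈k = ≤-trans floor≤ (≤-reflexive w≈k) , floor-greatest (≤-reflexive˘ w≈k)

  private
    module Meet i j = Floor (operation C meet (element i) (element j)) (bottom-∧ i j)
    module Under i j = Floor (operation C under (element i) (element j)) (bottom-\\ i j)
    module Over i j = Floor (operation C over (element i) (element j)) (bottom-// i j)

    join-index mult-index : Op₂ (Fin size)
    join-index i j = proj₁ (∨-image i j)
    mult-index i j = proj₁ (·-image i j)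

    join≤ : ∀ i j → element (join-index i j) ≤ (element i ∨ element j)
    join≤ i j = ≤-reflexive (proj₂ (∨-image i j))

    ≤join : ∀ i j → (element i ∨ element j) ≤ element (join-index i j)
    ≤join i j = ≤-reflexive˘ (proj₂ (∨-image i j))

    mult≤ : ∀ i j → element (mult-index i j) ≤ (element i · element j)
    mult≤ i j = ≤-reflexive (proj₂ (·-image i j))

    ≤mult : ∀ i j → (element i · element j) ≤ element (mult-index i j)
    ≤mult i j = ≤-reflexive˘ (proj₂ (·-image i j))

    e≤ : e ≤ element (proj₁ e-image)
    e≤ = ≤-reflexive˘ (proj₂ e-image)

    ≤e : element (proj₁ e-image) ≤ e
    ≤e = ≤-reflexive (proj₂ e-image)

    ∣_∣ : Lift c (Fin size) → Carrier
    ∣ i ∣ = element (lower i)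

  residuatedPreorder : ResiduatedPreorder c ℓ
  residuatedPreorder = record
    { Carrier     = Lift c (Fin size)
    ; _≲_         = λ i j → ∣ i ∣ ≤ ∣ j ∣
    ; _∧_         = λ (lift i) (lift j) → lift (Meet.floor i j)
    ; _∨_         = λ (lift i) (lift j) → lift (join-index i j)
    ; _·_         = λ (lift i) (lift j) → lift (mult-index i j)
    ; _\\_        = λ (lift i) (lift j) → lift (Under.floor i j)
    ; _//_        = λ (lift i) (lift j) → lift (Over.floor i j)
    ; e           = lift (proj₁ e-image)
    ; ≲-refl      = ≤-refl
    ; ≲-trans     = ≤-trans
    ; supremum    = λ (lift i) (lift j) →
        ≤-trans (x≤x∨y _ _) (≤join i j) , ≤-trans (y≤x∨y _ _) (≤join i j) ,
        λ _ p q → ≤-trans (join≤ i j) (∨-least p q)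
    ; infimum     = λ (lift i) (lift j) →
        ≤-trans (Meet.floor≤ i j) (x∧y≤x _ _) , ≤-trans (Meet.floor≤ i j) (x∧y≤y _ _) ,
        λ _ p q → Meet.floor-greatest i j (∧-greatest p q)
    ; ·-assoc     = λ (lift i) (lift j) (lift k) →
        ≤-trans (mult≤ _ _) (≤-trans (·-monoˡ (mult≤ i j)) (≤-trans ·-assocˡ
          (≤-trans (·-monoʳ (≤mult j k)) (≤mult _ _)))) ,
        ≤-trans (mult≤ _ _) (≤-trans (·-monoʳ (mult≤ j k)) (≤-trans ·-assocʳ
          (≤-trans (·-monoˡ (≤mult i j)) (≤mult _ _))))
    ; ·-identityˡ = λ (lift i) →
        ≤-trans (mult≤ _ _) (≤-trans (·-monoˡ ≤e) e·x≤x) ,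
        ≤-trans x≤e·x (≤-trans (·-monoˡ e≤) (≤mult _ _))
    ; ·-identityʳ = λ (lift i) →
        ≤-trans (mult≤ _ _) (≤-trans (·-monoʳ ≤e) x·e≤x) ,
        ≤-trans x≤x·e (≤-trans (·-monoʳ e≤) (≤mult _ _))
    ; \\-residual = λ (lift i) (lift j) (lift k) → mk⇔
        (λ p → ≤-trans (mult≤ i j) (\\-elim (≤-trans p (Under.floor≤ i k))))
        (λ p → Under.floor-greatest i k (\\-intro (≤-trans (≤mult i j) p)))
    -- For both residuals, products are those of `C`, so residuation in `C` applies, and taking the
    -- floor loses no element of the reduct.
    ; //-residual = λ (lift i) (lift j) (lift k) → mk⇔
        (λ p → Over.floor-greatest k j (//-intro (≤-trans (≤mult i j) p)))
        (λ p → ≤-trans (mult≤ i j) (//-elim (≤-trans p (Over.floor≤ k j))))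
    }

  algebra : ResiduatedLattice c ℓ
  algebra = ResiduatedPreorder.residuatedLattice residuatedPreorder

  ≤-reflects : ∀ i j → ResiduatedLattice._≤_ algebra i j → ∣ i ∣ ≤ ∣ j ∣
  ≤-reflects i j = Equivalence.to (ResiduatedPreorder.≤⇔≲ residuatedPreorder i j)

  preserves-operation : ∀ f i j k → operation C f ∣ i ∣ ∣ j ∣ ≈ ∣ k ∣ →
                        ResiduatedLattice._≈_ algebra (operation algebra f i j) k
  preserves-operation meet  (lift i) (lift j) k eq = Meet.floor-exact i j eq
  preserves-operation join  (lift i) (lift j) k eq =
    ≤-trans (join≤ i j) (≤-reflexive eq) , ≤-trans (≤-reflexive˘ eq) (≤join i j)
  preserves-operation mult  (lift i) (lift j) k eq =
    ≤-trans (mult≤ i j) (≤-reflexive eq) , ≤-trans (≤-reflexive˘ eq) (≤mult i j)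
  preserves-operation under (lift i) (lift j) k eq = Under.floor-exact i j eq
  preserves-operation over  (lift i) (lift j) k eq = Over.floor-exact i j eq

  preserves-e : ∀ k → e ≈ ∣ k ∣ → ResiduatedLattice._≈_ algebra (ResiduatedLattice.e algebra) k
  preserves-e k eq = ≤-trans ≤e (≤-reflexive eq) , ≤-trans (≤-reflexive˘ eq) e≤

  -- Joins, products and `e` are inherited from `C`, whereas meets and residuals may change; hence
  -- the restriction to the reduct language.
  element-reductValue : ∀ ρ t → ∣ reductValue algebra ρ t ∣ ≈ reductValue C (∣_∣ ∘ ρ) t
  element-reductValue ρ (var i)        = ≈.refl
  element-reductValue ρ unit           = proj₂ e-image
  element-reductValue ρ (app join s t) = ≈.trans (proj₂ (∨-image _ _))
    (IsLattice.∨-cong isLattice (element-reductValue ρ s) (element-reductValue ρ t))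
  element-reductValue ρ (app mult s t) = ≈.trans (proj₂ (·-image _ _))
    (IsMonoid.∙-cong isMonoid (element-reductValue ρ s) (element-reductValue ρ t))

  -- Meant for a quotient `Z` by a larger filter in which the formula has been realized; `transfer`
  -- pulls equalities of `Z` back to `C`.
  holds-truncation : ∀ (Z : ResiduatedLattice c ℓ) ζ ρ →
    (∀ s t → ResiduatedLattice._≈_ Z (reductValue Z ζ s) (reductValue Z ζ t) →
             reductValue C (∣_∣ ∘ ρ) s ≈ reductValue C (∣_∣ ∘ ρ) t) →
    ∀ φ → Semantics.Holds Z ζ φ → Semantics.Holds algebra ρ φ
  holds-truncation Z ζ ρ transfer = Holds-map Z algebra ζ ρ λ s t s≈t →
    let eq = ≈.trans (element-reductValue ρ s) (≈.trans (transfer s t s≈t)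
               (≈.sym (element-reductValue ρ t)))
    in ≤-reflexive eq , ≤-reflexive˘ eq

-- Joins of sublists with a common lower bound

joins : ∀ {a} {X : Set a} → Op₂ X → X → List X → List X
joins _∨_ m []       = [ m ]
joins _∨_ m (g ∷ gs) = joins _∨_ m gs ++ map (g ∨_) (joins _∨_ m gs)

module Joins {c ℓ : Level} (C : ResiduatedLattice c ℓ) (m : ResiduatedLattice.Carrier C) where
  open Properties C
  open SetoidMembership setoid using () renaming (_∈_ to _∈ₛ_)

  Join : List Carrier → Carrier → Set (c ⊔ ℓ)
  Join gs x = x ∈ₛ joins _∨_ m gs

  join-resp : ∀ {gs x y} → x ≈ y → Join gs x → Join gs y
  join-resp = ∈-resp-≈ setoid

  join-bottom : ∀ gs → Join gs m
  join-bottom []       = here ≈.refl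
  join-bottom (g ∷ gs) = Anyₚ.++⁺ˡ (join-bottom gs)

  join-cons : ∀ {g} gs {x} → Join gs x → Join (g ∷ gs) (g ∨ x)
  join-cons {g} gs p = Anyₚ.++⁺ʳ (joins _∨_ m gs)
    (Anyₚ.map⁺ (Any.map (IsLattice.∨-cong isLattice ≈.refl) p))

  join-uncons : ∀ {g gs x} → Join (g ∷ gs) x → Join gs x ⊎ ∃ λ y → Join gs y × x ≈ (g ∨ y)
  join-uncons {g} {gs} p = Sum.map id split (Anyₚ.++⁻ (joins _∨_ m gs) p)
    where
    split : ∀ {x} → x ∈ₛ map (g ∨_) (joins _∨_ m gs) → ∃ λ y → Join gs y × x ≈ (g ∨ y)
    split q with find (Anyₚ.map⁻ q)
    ... | y , y∈ , x≈ = y , Any.map ≈.reflexive y∈ , x≈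

  join-generator : ∀ {g} gs → g ∈ gs → m ≤ g → Join gs g
  join-generator (g ∷ gs) (here refl) m≤g =
    join-resp {g ∷ gs} (≤-antisym (∨-least ≤-refl m≤g) (x≤x∨y _ _)) (join-cons gs (join-bottom gs))
  join-generator (_ ∷ gs) (there g∈) m≤g = Anyₚ.++⁺ˡ (join-generator gs g∈ m≤g)

  -- Induction on the generators: `g` occurs in the result if it occurs in either operand, and the
  -- remainders are joined recursively.
  join-∨ : ∀ gs {x y} → Join gs x → Join gs y → Join gs (x ∨ y)
  join-∨ [] (here x≈m) (here y≈m) = here
    (≤-antisym (∨-least (≤-reflexive x≈m) (≤-reflexive y≈m))
               (≤-trans (≤-reflexive˘ x≈m) (x≤x∨y _ _)))
  join-∨ (g ∷ gs) p q with join-uncons {g} {gs} p | join-uncons {g} {gs} q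
  ... | inj₁ p′ | inj₁ q′ = Anyₚ.++⁺ˡ (join-∨ gs p′ q′)
  ... | inj₁ p′ | inj₂ (y , q′ , y≈) = join-resp {g ∷ gs}
    (≤-antisym
      (∨-least (≤-trans (x≤x∨y _ _) (≤-trans (≤-reflexive˘ y≈) (y≤x∨y _ _)))
               (∨-mono ≤-refl (≤-trans (y≤x∨y _ _) (≤-reflexive˘ y≈))))
      (∨-least (≤-trans (x≤x∨y _ _) (y≤x∨y _ _))
               (≤-trans (≤-reflexive y≈) (∨-mono ≤-refl (y≤x∨y _ _)))))
    (join-cons gs (join-∨ gs p′ q′))
  ... | inj₂ (x , p′ , x≈) | inj₁ q′ = join-resp {g ∷ gs}
    (≈.trans (≈.sym (IsLattice.∨-assoc isLattice _ _ _))
             (IsLattice.∨-cong isLattice (≈.sym x≈) ≈.refl))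
    (join-cons gs (join-∨ gs p′ q′))
  ... | inj₂ (x , p′ , x≈) | inj₂ (y , q′ , y≈) = join-resp {g ∷ gs}
    (≤-antisym
      (∨-least (≤-trans (x≤x∨y _ _) (≤-trans (≤-reflexive˘ x≈) (x≤x∨y _ _)))
        (∨-mono (≤-trans (y≤x∨y _ _) (≤-reflexive˘ x≈)) (≤-trans (y≤x∨y _ _) (≤-reflexive˘ y≈))))
      (∨-least (≤-trans (≤-reflexive x≈) (∨-mono ≤-refl (x≤x∨y _ _)))
               (≤-trans (≤-reflexive y≈) (∨-mono ≤-refl (y≤x∨y _ _)))))
    (join-cons gs (join-∨ gs p′ q′))

  -- Every join arises from `m` by adding generators one at a time. `P` must respect `≈` because
  -- membership in the list is up to `≈`.
  join-induction : ∀ {p} (P : Carrier → Set p) → (∀ {x y} → x ≈ y → P x → P y) → ∀ gs →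
                   P m → (∀ {g x} → g ∈ gs → P x → P (g ∨ x)) → ∀ {x} → Join gs x → P x
  join-induction P resp []       Pm P∨ (here x≈m) = resp (≈.sym x≈m) Pm
  join-induction P resp (g ∷ gs) Pm P∨ p with join-uncons {g} {gs} p
  ... | inj₁ p′            = join-induction P resp gs Pm (P∨ ∘ there) p′
  ... | inj₂ (y , p′ , x≈) =
    resp (≈.sym x≈) (P∨ (here refl) (join-induction P resp gs Pm (P∨ ∘ there) p′))

  module _ (gs : List Carrier) (e∈gs : e ∈ gs)
           (m≤ : ∀ {g} → g ∈ gs → m ≤ g)
           (g·m≤e : ∀ {g} → g ∈ gs → (g · m) ≤ e)
           (m·g≤e : ∀ {g} → g ∈ gs → (m · g) ≤ e)
           (selective : ∀ {g h} → g ∈ m ∷ gs → h ∈ m ∷ gs → g · h ≈ g ⊎ g · h ≈ h) where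

    private
      m≤e : m ≤ e
      m≤e = m≤ e∈gs

      resp-≤ʳ : ∀ {x y z} → x ≈ y → z ≤ x → z ≤ y
      resp-≤ʳ x≈y z≤x = ≤-trans z≤x (≤-reflexive x≈y)

      -- If g · m ≈ g then g ≤ e, so g · m ≤ m in either case.
      g·m≤m : ∀ {g} → g ∈ gs → (g · m) ≤ m
      g·m≤m g∈ with selective (there g∈) (here refl)
      ... | inj₁ eq = ·-negativeˡ (≤-trans (≤-reflexive˘ eq) (g·m≤e g∈))
      ... | inj₂ eq = ≤-reflexive eq

      m·g≤m : ∀ {g} → g ∈ gs → (m · g) ≤ m
      m·g≤m g∈ with selective (here refl) (there g∈)
      ... | inj₁ eq = ≤-reflexive eq
      ... | inj₂ eq = ·-negativeʳ (≤-trans (≤-reflexive˘ eq) (m·g≤e g∈))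

      bottom≤ : ∀ {x} → Join gs x → m ≤ x
      bottom≤ = join-induction (m ≤_) resp-≤ʳ gs ≤-refl (λ _ m≤x → ≤-trans m≤x (y≤x∨y _ _))

      -- The elements with this property form the down-set of `m // m`, which is closed under joins,
      -- so the generators decide.
      x·m≤m : ∀ {x} → Join gs x → (x · m) ≤ m
      x·m≤m p = //-elim (join-induction (_≤ (m // m))
        (λ x≈y x≤z → ≤-trans (≤-reflexive˘ x≈y) x≤z) gs
        (//-intro (·-negativeˡ m≤e))
        (λ g∈ x≤ → ∨-least (//-intro (g·m≤m g∈)) x≤) p)

      m·x≤m : ∀ {x} → Join gs x → (m · x) ≤ m
      m·x≤m p = \\-elim (join-induction (_≤ (m \\ m))
        (λ x≈y x≤z → ≤-trans (≤-reflexive˘ x≈y) x≤z) gs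
        (\\-intro (·-negativeˡ m≤e))
        (λ g∈ x≤ → ∨-least (\\-intro (m·g≤m g∈)) x≤) p)

      ·-∨-distribˡ : ∀ x y z → x · (y ∨ z) ≈ (x · y) ∨ (x · z)
      ·-∨-distribˡ x y z = ≤-antisym
        (\\-elim (∨-least (\\-intro (x≤x∨y _ _)) (\\-intro (y≤x∨y _ _))))
        (∨-least (·-monoʳ (x≤x∨y _ _)) (·-monoʳ (y≤x∨y _ _)))

      ·-∨-distribʳ : ∀ x y z → (y ∨ z) · x ≈ (y · x) ∨ (z · x)
      ·-∨-distribʳ x y z = ≤-antisym
        (//-elim (∨-least (//-intro (x≤x∨y _ _)) (//-intro (y≤x∨y _ _))))
        (∨-least (·-monoˡ (x≤x∨y _ _)) (·-monoˡ (y≤x∨y _ _)))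

      join-base : ∀ {g} → g ∈ m ∷ gs → Join gs g
      join-base (here refl) = join-bottom gs
      join-base (there g∈)  = join-generator gs g∈ (m≤ g∈)

      base-· : ∀ {g h} → g ∈ m ∷ gs → h ∈ m ∷ gs → Join gs (g · h)
      base-· g∈ h∈ with selective g∈ h∈
      ... | inj₁ eq = join-resp {gs} (≈.sym eq) (join-base g∈)
      ... | inj₂ eq = join-resp {gs} (≈.sym eq) (join-base h∈)

      base-·-join : ∀ {g x} → g ∈ m ∷ gs → Join gs x → Join gs (g · x)
      base-·-join {g} g∈ = join-induction (λ x → Join gs (g · x))
        (join-resp {gs} ∘ IsMonoid.∙-cong isMonoid ≈.refl) gs
        (base-· g∈ (here refl))
        (λ h∈ p → join-resp {gs} (≈.sym (·-∨-distribˡ _ _ _))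
                    (join-∨ gs (base-· g∈ (there h∈)) p))

      -- Products distribute over joins, which leaves products of generators and `m`; by `selective`
      -- each of these equals one of its factors.
      join-· : ∀ {x y} → Join gs x → Join gs y → Join gs (x · y)
      join-· {y = y} p q = join-induction (λ x → Join gs (x · y))
        (λ x≈x′ → join-resp {gs} (IsMonoid.∙-cong isMonoid x≈x′ ≈.refl)) gs
        (base-·-join (here refl) q)
        (λ g∈ r → join-resp {gs} (≈.sym (·-∨-distribʳ _ _ _))
                    (join-∨ gs (base-·-join (there g∈) q) r))
        p

      elements : List Carrier
      elements = joins _∨_ m gs

      join-lookup : ∀ i → Join gs (lookup elements i)
      join-lookup i = ∈ₛ-lookup setoid elements i

      index-image : ∀ {x} → Join gs x → ∃ λ i → lookup elements i ≈ x
      index-image p = Any.index p , ≈.sym (Anyₚ.lookup-index p)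

      ⊥≤ : ∀ {x} → m ≤ x → lookup elements (Any.index (join-bottom gs)) ≤ x
      ⊥≤ = ≤-trans (≤-reflexive (proj₂ (index-image (join-bottom gs))))

    -- The lower bounds on residuals hold because multiplying `m` by a join on either side gives at
    -- most `m`, which is below every join.
    finiteReduct : FiniteReduct C
    finiteReduct = record
      { size      = length elements
      ; element   = lookup elements
      ; ∨-image   = λ i j → index-image (join-∨ gs (join-lookup i) (join-lookup j))
      ; ·-image   = λ i j → index-image (join-· (join-lookup i) (join-lookup j))
      ; e-image   = index-image (join-generator gs e∈gs m≤e)
      ; bottom    = Any.index (join-bottom gs)
      ; bottom-∧  = λ i j → ⊥≤ (∧-greatest (bottom≤ (join-lookup i)) (bottom≤ (join-lookup j)))
      ; bottom-\\ = λ i j → ⊥≤ (\\-intro (≤-trans (x·m≤m (join-lookup i)) (bottom≤ (join-lookup j))))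
      ; bottom-// = λ i j → ⊥≤ (//-intro (≤-trans (m·x≤m (join-lookup j)) (bottom≤ (join-lookup i))))
      }

-- Separation of two elements by a finite member of K

Member : ∀ {c ℓ} (A : ResiduatedLattice c ℓ) → List (ResiduatedLattice.Carrier A) → Set (c ⊔ ℓ)
Member A B = Setoid.Carrier (subsetoid A B)

-- An embedding without injectivity, which is recovered only in the product over all pairs to be
-- separated.
record PartialHomomorphism {c ℓ c′ ℓ′ : Level} (A : ResiduatedLattice c ℓ)
         (B : List (ResiduatedLattice.Carrier A)) (D : ResiduatedLattice c′ ℓ′) :
         Set (c ⊔ ℓ ⊔ c′ ⊔ ℓ′) where
  private
    module A = ResiduatedLattice A
    module D = ResiduatedLattice D
  field
    to                  : Member A B → D.Carrier
    to-cong             : ∀ x y → proj₁ x A.≈ proj₁ y → to x D.≈ to y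
    preserves-operation : ∀ f x y z →
      operation A f (proj₁ x) (proj₁ y) A.≈ proj₁ z → operation D f (to x) (to y) D.≈ to z
    preserves-e         : ∀ z → A.e A.≈ proj₁ z → D.e D.≈ to z

-- Finiteness with repetitions allowed, a form that passes easily to products.
Enumerable : ∀ {c ℓ} → Pred (ResiduatedLattice c ℓ) (c ⊔ ℓ)
Enumerable D = ∃ λ xs → ∀ x → x ∈ₛ xs
  where open SetoidMembership (ResiduatedLattice.setoid D) using () renaming (_∈_ to _∈ₛ_)

module LowerBound {c ℓ : Level} (A : ResiduatedLattice c ℓ) where
  open Properties A

  -- The residuals put the bound `m` below `e` even after multiplication by a generator on either
  -- side. Together with conservativity this makes products of `m` with generators fall below `m`.
  lowerBound : List Carrier → Carrier
  lowerBound = foldr (λ g m → (g ∧ (g \\ e) ∧ (e // g)) ∧ m) e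

  lowerBound≤ : ∀ {g} gs → g ∈ gs → lowerBound gs ≤ (g ∧ (g \\ e) ∧ (e // g))
  lowerBound≤ (g ∷ gs) (here refl) = x∧y≤x _ _
  lowerBound≤ (_ ∷ gs) (there g∈)  = ≤-trans (x∧y≤y _ _) (lowerBound≤ gs g∈)

  lowerBound≤g : ∀ {g} gs → g ∈ gs → lowerBound gs ≤ g
  lowerBound≤g gs g∈ = ≤-trans (lowerBound≤ gs g∈) (x∧y≤x _ _)

  g·lowerBound≤e : ∀ {g} gs → g ∈ gs → (g · lowerBound gs) ≤ e
  g·lowerBound≤e gs g∈ =
    \\-elim (≤-trans (lowerBound≤ gs g∈) (≤-trans (x∧y≤y _ _) (x∧y≤x _ _)))

  lowerBound·g≤e : ∀ {g} gs → g ∈ gs → (lowerBound gs · g) ≤ e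
  lowerBound·g≤e gs g∈ =
    //-elim (≤-trans (lowerBound≤ gs g∈) (≤-trans (x∧y≤y _ _) (x∧y≤y _ _)))

idempotency conservativity : PositiveFormula
idempotency    = equation (app mult (var 0) (var 0) , var 0)
conservativity = equation (app mult (var 0) (var 1) , var 0) or
                 equation (app mult (var 0) (var 1) , var 1)

-- Idempotency is itself a formula valid in `K`, and so is every member of `Σ`.
valid⇒∈K : ∀ {c ℓ k p} (K : Pred (ResiduatedLattice c ℓ) k) (Σ : Pred PositiveFormula p) →
           DefinedRelativeToIdempotentBy K Σ → ∀ D →
           (∀ φ → ValidIn K φ → SatisfiesUniversally D φ) → K D
valid⇒∈K K Σ K≐ D valid = proj₂ K≐
  ( (λ x → valid idempotency (λ C∈K ρ → proj₁ (proj₁ K≐ C∈K) (ρ 0)) (λ _ → x))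
  , λ φ φ∈Σ → valid φ (λ C∈K → proj₂ (proj₁ K≐ C∈K) φ φ∈Σ))

module Separation {c ℓ k p : Level} (em : ExcludedMiddle (c ⊔ ℓ))
                  (K : Pred (ResiduatedLattice c ℓ) k) (K⊆Conservative : K ⊆ Conservative)
                  (Σ : Pred PositiveFormula p) (K≐ : DefinedRelativeToIdempotentBy K Σ)
                  (A : ResiduatedLattice c ℓ) (A∈V : VarietyGeneratedBy K A)
                  (B : List (ResiduatedLattice.Carrier A)) (x y : Member A B)
                  (x≰y : ¬ ResiduatedLattice._≤_ A (proj₁ x) (proj₁ y)) where
  open FilterProperties A
  open LowerBound A
  open Saturation em K A A∈V (operation A under (proj₁ x) (proj₁ y))

  private
    gs : List Carrier
    gs = e ∷ B

    m : Carrier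
    m = lowerBound gs

    -- The elements whose mutual inequalities are to be settled: the joins form the reduct, and the
    -- products of base elements are needed to state `selective`.
    us : List Carrier
    us = (m ∷ gs) ++ joins _∨_ m gs ++ cartesianProductWith _·_ (m ∷ gs) (m ∷ gs)

    base⊆us : ∀ {u} → u ∈ m ∷ gs → u ∈ us
    base⊆us = Anyₚ.++⁺ˡ

    joins⊆us : ∀ {u} → u ∈ joins _∨_ m gs → u ∈ us
    joins⊆us = Anyₚ.++⁺ʳ (m ∷ gs) ∘ Anyₚ.++⁺ˡ

    products⊆us : ∀ {u v} → u ∈ m ∷ gs → v ∈ m ∷ gs → u · v ∈ us
    products⊆us u∈ v∈ =
      Anyₚ.++⁺ʳ (m ∷ gs) (Anyₚ.++⁺ʳ (joins _∨_ m gs) (∈-cartesianProductWith⁺ _·_ u∈ v∈))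

    saturation : ∃ λ ys → [] ⊑ ys ×
                 (∀ {u} → u ∈ cartesianProductWith _\\_ us us → Saturated ys u)
    -- The starting filter is the up-set of `e`, which avoids the residual `s` precisely because `x`
    -- is not below `y`.
    saturation = saturate (cartesianProductWith _\\_ us us) (x≰y ∘ e≤x\\y⇒x≤y ∘ Filter[]⇒e≤)

    ys : List Carrier
    ys = proj₁ saturation

    s∉ : ¬ Filter A ys (proj₁ x \\ proj₁ y)
    s∉ = proj₂ (proj₁ (proj₂ saturation))

    module Q = Quotient em A
    module C = Properties (Q.algebra ys)

    stable : ∀ {zs u v} → ys ⊑ zs → u ∈ us → v ∈ us → Q._≲_ zs u v → Q._≲_ ys u v
    stable ys⊑zs u∈ v∈ = Q.Filter⇒≲ ys
      ∘ proj₂ (proj₂ saturation) (∈-cartesianProductWith⁺ _\\_ u∈ v∈) ys⊑zs ∘ Q.≲⇒Filter _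

    stable-≈ : ∀ {zs u v} → ys ⊑ zs → u ∈ us → v ∈ us →
               ResiduatedLattice._≈_ (Q.algebra zs) u v → u C.≈ v
    stable-≈ ys⊑zs u∈ v∈ (p , q) = stable ys⊑zs u∈ v∈ p , stable ys⊑zs v∈ u∈ q

    -- Values of terms agree with members of `us` only up to the equality of the quotient by `ys`;
    -- this equality persists in the quotient by the larger filter.
    stable-≈-up-to : ∀ {zs u v u′ v′} → ys ⊑ zs → u′ ∈ us → v′ ∈ us → u′ C.≈ u → v′ C.≈ v →
                     ResiduatedLattice._≈_ (Q.algebra zs) u v → u C.≈ v
    stable-≈-up-to {zs} ys⊑zs u′∈ v′∈ u′≈u v′≈v u≈v = C.≈.trans (C.≈.sym u′≈u) (C.≈.trans
      (stable-≈ ys⊑zs u′∈ v′∈ (Z.≈.trans (raise u′≈u) (Z.≈.trans u≈v (Z.≈.sym (raise v′≈v)))))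
      v′≈v)
      where
      module Z = Properties (Q.algebra zs)
      raise : ∀ {a b} → a C.≈ b → a Z.≈ b
      raise (p , q) = Q.Filter⇒≲ zs (proj₁ ys⊑zs _ (Q.≲⇒Filter ys p)) ,
                      Q.Filter⇒≲ zs (proj₁ ys⊑zs _ (Q.≲⇒Filter ys q))

    -- For each pair, one of the two equations holds in some larger quotient, and saturation brings
    -- it back to the fixed filter.
    selective : ∀ {g h} → g ∈ m ∷ gs → h ∈ m ∷ gs → (g · h) C.≈ g ⊎ (g · h) C.≈ h
    selective {g} {h} g∈ h∈
      with realize conservativity (λ C∈K ρ → K⊆Conservative C∈K (ρ 0) (ρ 1)) (g ◂ λ _ → h) s∉
    ... | zs , ys⊑zs , inj₁ eq = inj₁ (stable-≈ ys⊑zs (products⊆us g∈ h∈) (base⊆us g∈) eq)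
    ... | zs , ys⊑zs , inj₂ eq = inj₂ (stable-≈ ys⊑zs (products⊆us g∈ h∈) (base⊆us h∈) eq)

    open Joins (Q.algebra ys) m

    reduct : FiniteReduct (Q.algebra ys)
    reduct = finiteReduct gs (here refl)
      (λ g∈ → Q.≤⇒≤/ ys (lowerBound≤g gs g∈))
      (λ g∈ → Q.≤⇒≤/ ys (g·lowerBound≤e gs g∈))
      (λ g∈ → Q.≤⇒≤/ ys (lowerBound·g≤e gs g∈))
      selective

    module T = Truncation (resize c em) (Q.algebra ys) reduct

  D : ResiduatedLattice c ℓ
  D = T.algebra

  private
    module D = Properties D

    ∣_∣ : D.Carrier → Carrier
    ∣ i ∣ = FiniteReduct.element reduct (lower i)

    ∣_∣∈us : ∀ i → ∣ i ∣ ∈ us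
    ∣ i ∣∈us = joins⊆us (∈-lookup (lower i))

    transfer : ∀ ρ {zs} → ys ⊑ zs → ∀ s t →
      ResiduatedLattice._≈_ (Q.algebra zs) (reductValue (Q.algebra zs) (∣_∣ ∘ ρ) s)
                                           (reductValue (Q.algebra zs) (∣_∣ ∘ ρ) t) →
      reductValue (Q.algebra ys) (∣_∣ ∘ ρ) s C.≈ reductValue (Q.algebra ys) (∣_∣ ∘ ρ) t
    transfer ρ {zs} ys⊑zs s t s≈t = stable-≈-up-to ys⊑zs
      ∣ reductValue D ρ s ∣∈us ∣ reductValue D ρ t ∣∈us
      (T.element-reductValue ρ s) (T.element-reductValue ρ t)
      (subst₂ (ResiduatedLattice._≈_ (Q.algebra zs)) (quotient≡ s) (quotient≡ t) s≈t)
      where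
      quotient≡ : ∀ r → reductValue (Q.algebra zs) (∣_∣ ∘ ρ) r ≡
                        reductValue (Q.algebra ys) (∣_∣ ∘ ρ) r
      quotient≡ r = trans (Q.reductValue-quotient zs (∣_∣ ∘ ρ) r)
                          (sym (Q.reductValue-quotient ys (∣_∣ ∘ ρ) r))

    -- A formula is realized in a larger quotient depending on `ρ`. The values of its terms are
    -- elements of the reduct, so saturation returns the equalities to the quotient by `ys`, whence
    -- they hold in `D`.
    D-valid : ∀ φ → ValidIn K φ → SatisfiesUniversally D φ
    D-valid φ valid ρ =
      let zs , ys⊑zs , holds = realize φ valid (∣_∣ ∘ ρ) s∉
      in T.holds-truncation (Q.algebra zs) (∣_∣ ∘ ρ) ρ (transfer ρ ys⊑zs) φ holds

  D∈K : K D
  D∈K = valid⇒∈K K Σ K≐ D D-valid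

  D-enumerable : Enumerable D
  D-enumerable = map lift (allFin _) ,
    λ (lift i) → Anyₚ.map⁺ (Any.map (λ { refl → D.≈.refl }) (∈-allFin i))

  private
    member-join : ∀ (b : Member A B) → Join gs (proj₁ b)
    member-join (b , b∈B) =
      let (g , g∈ , b≈g) = find b∈B in
      join-resp {gs} (C.≈.sym (Q.≈⇒≈/ ys b≈g))
           (join-generator gs (there g∈) (Q.≤⇒≤/ ys (lowerBound≤g gs (there g∈))))

    code : Member A B → D.Carrier
    code b = lift (Any.index (member-join b))

    ∣code∣ : ∀ b → ∣ code b ∣ C.≈ proj₁ b
    ∣code∣ b = C.≈.sym (Anyₚ.lookup-index (member-join b))

    operation-quotient : ∀ f u v → operation (Q.algebra ys) f u v ≡ operation A f u v
    operation-quotient meet  u v = refl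
    operation-quotient join  u v = refl
    operation-quotient mult  u v = refl
    operation-quotient under u v = refl
    operation-quotient over  u v = refl

  homomorphism : PartialHomomorphism A B D
  homomorphism = record
    { to                  = code
    ; to-cong             = λ u v u≈v →
        let eq = C.≈.trans (∣code∣ u) (C.≈.trans (Q.≈⇒≈/ ys u≈v) (C.≈.sym (∣code∣ v)))
        in C.≤-reflexive eq , C.≤-reflexive˘ eq
    ; preserves-operation = λ f u v w eq → T.preserves-operation f (code u) (code v) (code w)
        (C.≈.trans (operation-cong (Q.algebra ys) f (∣code∣ u) (∣code∣ v))
          (C.≈.trans (subst (C._≈ proj₁ w) (sym (operation-quotient f _ _)) (Q.≈⇒≈/ ys eq))
            (C.≈.sym (∣code∣ w))))
    ; preserves-e         = λ w eq → T.preserves-e (code w)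
        (C.≈.trans (Q.≈⇒≈/ ys eq) (C.≈.sym (∣code∣ w)))
    }

  private
    code-reflects-≤ : ∀ u v → ResiduatedLattice._≤_ D (code u) (code v) → Q._≲_ ys (proj₁ u) (proj₁ v)
    code-reflects-≤ u v hu≤hv = Q.≤/⇒≲ ys {proj₁ u} {proj₁ v}
      (C.≤-resp-≈ (∣code∣ u) (∣code∣ v) (T.≤-reflects (code u) (code v) hu≤hv))

    to≡code : ∀ b → PartialHomomorphism.to homomorphism b ≡ code b
    to≡code _ = refl

  -- An inequality between the images would hold in the quotient as well, putting the avoided
  -- residual into the filter.
  separates : ¬ (ResiduatedLattice._≤_ D (PartialHomomorphism.to homomorphism x)
                                         (PartialHomomorphism.to homomorphism y))
  separates hx≤hy = s∉ (Q.≲⇒Filter ys (code-reflects-≤ x y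
    (subst₂ (ResiduatedLattice._≤_ D) (to≡code x) (to≡code y) hx≤hy)))

-- Products

module Product {c ℓ : Level} (A D : ResiduatedLattice c ℓ) where
  private
    module A = Properties A
    module D = Properties D

  residuatedPreorder : ResiduatedPreorder c ℓ
  residuatedPreorder = record
    { Carrier     = A.Carrier × D.Carrier
    ; _≲_         = λ (a , d) (a′ , d′) → a A.≤ a′ × d D.≤ d′
    ; _∧_         = λ (a , d) (a′ , d′) → a A.∧ a′ , d D.∧ d′
    ; _∨_         = λ (a , d) (a′ , d′) → a A.∨ a′ , d D.∨ d′
    ; _·_         = λ (a , d) (a′ , d′) → a A.· a′ , d D.· d′
    ; _\\_        = λ (a , d) (a′ , d′) → a A.\\ a′ , d D.\\ d′
    ; _//_        = λ (a , d) (a′ , d′) → a A.// a′ , d D.// d′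
    ; e           = A.e , D.e
    ; ≲-refl      = A.≤-refl , D.≤-refl
    ; ≲-trans     = λ (p , q) (p′ , q′) → A.≤-trans p p′ , D.≤-trans q q′
    ; supremum    = λ _ _ → (A.x≤x∨y _ _ , D.x≤x∨y _ _) , (A.y≤x∨y _ _ , D.y≤x∨y _ _) ,
                            λ _ (p , q) (p′ , q′) → A.∨-least p p′ , D.∨-least q q′
    ; infimum     = λ _ _ → (A.x∧y≤x _ _ , D.x∧y≤x _ _) , (A.x∧y≤y _ _ , D.x∧y≤y _ _) ,
                            λ _ (p , q) (p′ , q′) → A.∧-greatest p p′ , D.∧-greatest q q′
    ; ·-assoc     = λ _ _ _ → (A.·-assocˡ , D.·-assocˡ) , (A.·-assocʳ , D.·-assocʳ)
    ; ·-identityˡ = λ _ → (A.e·x≤x , D.e·x≤x) , (A.x≤e·x , D.x≤e·x)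
    ; ·-identityʳ = λ _ → (A.x·e≤x , D.x·e≤x) , (A.x≤x·e , D.x≤x·e)
    ; \\-residual = λ _ _ _ → mk⇔ (λ (p , q) → A.\\-elim p , D.\\-elim q)
                                  (λ (p , q) → A.\\-intro p , D.\\-intro q)
    ; //-residual = λ _ _ _ → mk⇔ (λ (p , q) → A.//-intro p , D.//-intro q)
                                  (λ (p , q) → A.//-elim p , D.//-elim q)
    }

  algebra : ResiduatedLattice c ℓ
  algebra = ResiduatedPreorder.residuatedLattice residuatedPreorder

  private
    module P = ResiduatedLattice algebra

  pair-≈ : ∀ {a a′ d d′} → a A.≈ a′ → d D.≈ d′ → (a , d) P.≈ (a′ , d′)
  pair-≈ p q = (A.≤-reflexive p , D.≤-reflexive q) , (A.≤-reflexive˘ p , D.≤-reflexive˘ q)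

  ≤-components : ∀ {u v} → u P.≤ v → proj₁ u A.≤ proj₁ v × proj₂ u D.≤ proj₂ v
  ≤-components = Equivalence.to (ResiduatedPreorder.≤⇔≲ residuatedPreorder _ _)

  operation-product : ∀ f u v → operation algebra f u v ≡
    (operation A f (proj₁ u) (proj₁ v) , operation D f (proj₂ u) (proj₂ v))
  operation-product meet  u v = refl
  operation-product join  u v = refl
  operation-product mult  u v = refl
  operation-product under u v = refl
  operation-product over  u v = refl

  value-product : ∀ ρ t → value algebra ρ t ≡ (value A (proj₁ ∘ ρ) t , value D (proj₂ ∘ ρ) t)
  value-product ρ (var i)     = refl
  value-product ρ unit        = refl
  value-product ρ (app f s t) = trans
    (cong₂ (operation algebra f) (value-product ρ s) (value-product ρ t)) (operation-product f _ _)

  product∈V : ∀ {k} {K : Pred (ResiduatedLattice c ℓ) k} →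
              VarietyGeneratedBy K A → VarietyGeneratedBy K D → VarietyGeneratedBy K algebra
  product∈V A∈V D∈V E K⊆E (s , t) eq∈E ρ =
    subst₂ P._≈_ (sym (value-product ρ s)) (sym (value-product ρ t))
      (pair-≈ (A∈V E K⊆E (s , t) eq∈E (proj₁ ∘ ρ)) (D∈V E K⊆E (s , t) eq∈E (proj₂ ∘ ρ)))

  product-enumerable : Enumerable A → Enumerable D → Enumerable algebra
  product-enumerable (as , a∈) (ds , d∈) = cartesianProductWith _,_ as ds ,
    λ (a , d) → Anyₚ.cartesianProductWith⁺ _,_ pair-≈ (a∈ a) (d∈ d)

  product-homomorphism : ∀ {C : ResiduatedLattice c ℓ} {B} → PartialHomomorphism C B A →
                         PartialHomomorphism C B D → PartialHomomorphism C B algebra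
  product-homomorphism h h′ = record
    { to                  = λ b → to h b , to h′ b
    ; to-cong             = λ u v eq → pair-≈ (to-cong h u v eq) (to-cong h′ u v eq)
    ; preserves-operation = λ f u v w eq →
        subst (P._≈ (to h w , to h′ w)) (sym (operation-product f _ _))
          (pair-≈ (preserves-operation h f u v w eq) (preserves-operation h′ f u v w eq))
    ; preserves-e         = λ w eq → pair-≈ (preserves-e h w eq) (preserves-e h′ w eq)
    }
    where open PartialHomomorphism

-- The empty product, from which the recursion over pairs starts.
module Trivial (c ℓ : Level) where

  residuatedPreorder : ResiduatedPreorder c ℓ
  residuatedPreorder = record
    { Carrier     = ⊤
    ; _≲_         = λ _ _ → ⊤
    ; _∧_         = _
    ; _∨_         = _
    ; _·_         = _
    ; _\\_        = _
    ; _//_        = _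
    ; e           = _
    ; ≲-refl      = _
    ; ≲-trans     = _
    ; supremum    = _
    ; infimum     = _
    ; ·-assoc     = _
    ; ·-identityˡ = _
    ; ·-identityʳ = _
    ; \\-residual = λ _ _ _ → mk⇔ _ _
    ; //-residual = λ _ _ _ → mk⇔ _ _
    }

  algebra : ResiduatedLattice c ℓ
  algebra = ResiduatedPreorder.residuatedLattice residuatedPreorder

  enumerable : Enumerable algebra
  enumerable = [ _ ] , λ _ → here _

  homomorphism : ∀ {C : ResiduatedLattice c ℓ} {B} → PartialHomomorphism C B algebra
  homomorphism = _

-- Excluded middle decides `≈`, so repetitions can be deleted; positions in the resulting list are
-- then unique.
enumerable⇒finite : ∀ {c ℓ} → ExcludedMiddle ℓ → (D : ResiduatedLattice c ℓ) →
                    Enumerable D → Finite D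
enumerable⇒finite em D (xs , x∈xs) = length us , record
  { to        = index
  ; from      = lookup us
  ; to-cong   = λ {x} {y} x≈y → lookup-injective (deduplicate-! decSetoid xs) _ _
      (D.≈.trans (D.≈.sym (lookup-index (x∈us x))) (D.≈.trans x≈y (lookup-index (x∈us y))))
  ; from-cong = λ { refl → D.≈.refl }
  ; inverse   =
      (λ {i} {x} x≈ → lookup-injective (deduplicate-! decSetoid xs) _ _
        (D.≈.trans (D.≈.sym (lookup-index (x∈us x))) x≈))
    , (λ { {x} refl → D.≈.sym (lookup-index (x∈us x)) })
  }
  where
  module D = Properties D
  open SetoidMembership D.setoid using () renaming (_∈_ to _∈ₛ_)
  open Anyₚ using (lookup-index)

  decSetoid : DecSetoid _ _
  decSetoid = record
    { isDecEquivalence = record { isEquivalence = IsLattice.isEquivalence D.isLattice ; _≟_ = λ _ _ → em } }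

  us : List D.Carrier
  us = deduplicate (DecSetoid._≟_ decSetoid) xs

  x∈us : ∀ x → x ∈ₛ us
  x∈us x = ∈-deduplicate⁺ D.setoid (DecSetoid._≟_ decSetoid)
    (λ z≈y y≈x → D.≈.trans y≈x (D.≈.sym z≈y)) (x∈xs x)

  index : D.Carrier → Fin (length us)
  index x = Any.index (x∈us x)

  lookup-injective : ∀ {vs} → Unique D.setoid vs → ∀ i j → lookup vs i D.≈ lookup vs j → i ≡ j
  lookup-injective (_ ∷ _)  zero    zero    _  = refl
  lookup-injective (v∉ ∷ _) zero    (suc j) eq = contradiction eq (All.lookup v∉ (∈-lookup j))
  lookup-injective (v∉ ∷ _) (suc i) zero    eq =
    contradiction (D.≈.sym eq) (All.lookup v∉ (∈-lookup i))
  lookup-injective (_ ∷ u)  (suc i) (suc j) eq = cong suc (lookup-injective u i j eq)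

-- The product over all pairs and the embedding

module _ {c ℓ k p : Level} (em : ExcludedMiddle (c ⊔ ℓ))
         (K : Pred (ResiduatedLattice c ℓ) k) (K⊆Conservative : K ⊆ Conservative)
         (Σ : Pred PositiveFormula p) (K≐ : DefinedRelativeToIdempotentBy K Σ)
         (A : ResiduatedLattice c ℓ) (A∈V : VarietyGeneratedBy K A)
         (B : List (ResiduatedLattice.Carrier A)) where
  private
    module A = Properties A

  -- Membership is recorded for the variety because a product of conservative algebras need not be
  -- conservative.
  record SeparatingImage (ps : List (Member A B × Member A B)) : Set (lsuc (c ⊔ ℓ) ⊔ k) where
    field
      D            : ResiduatedLattice c ℓ
      D∈V          : VarietyGeneratedBy K D
      D-enumerable : Enumerable D
      homomorphism : PartialHomomorphism A B D
    open PartialHomomorphism homomorphism public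
    field
      reflects     : ∀ {x y} → (x , y) ∈ ps → ResiduatedLattice._≤_ D (to x) (to y) →
                     proj₁ x A.≤ proj₁ y

  private
    trivialImage : SeparatingImage []
    trivialImage = record
      { D            = Trivial.algebra c ℓ
      ; D∈V          = _
      ; D-enumerable = Trivial.enumerable c ℓ
      ; homomorphism = Trivial.homomorphism c ℓ
      ; reflects     = λ ()
      }

    skipPair : ∀ {x y ps} → proj₁ x A.≤ proj₁ y → SeparatingImage ps → SeparatingImage ((x , y) ∷ ps)
    skipPair x≤y image = record
      { D            = D
      ; D∈V          = D∈V
      ; D-enumerable = D-enumerable
      ; homomorphism = homomorphism
      ; reflects     = λ where
          (here refl) _ → x≤y
          (there xy∈)   → reflects xy∈
      }
      where open SeparatingImage image

    separatePair : ∀ {x y ps} (D₁ : ResiduatedLattice c ℓ) → VarietyGeneratedBy K D₁ → Enumerable D₁ →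
      (h : PartialHomomorphism A B D₁) →
      ¬ ResiduatedLattice._≤_ D₁ (PartialHomomorphism.to h x) (PartialHomomorphism.to h y) →
      SeparatingImage ps → SeparatingImage ((x , y) ∷ ps)
    separatePair D₁ D₁∈V D₁-enumerable h hx≰hy image = record
      { D            = P.algebra
      ; D∈V          = P.product∈V D₁∈V D∈V
      ; D-enumerable = P.product-enumerable D₁-enumerable D-enumerable
      ; homomorphism = P.product-homomorphism h homomorphism
      ; reflects     = λ where
          (here refl) hx≤hy → contradiction (proj₁ (P.≤-components hx≤hy)) hx≰hy
          (there xy∈) hx≤hy → reflects xy∈ (proj₂ (P.≤-components hx≤hy))
      }
      where
      open SeparatingImage image
      module P = Product D₁ D

  separatingImage : ∀ ps → SeparatingImage ps
  separatingImage [] = trivialImage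
  separatingImage ((x , y) ∷ ps) with resize c em {proj₁ x A.≤ proj₁ y}
  ... | yes x≤y = skipPair x≤y (separatingImage ps)
  -- The new factor is a member of `K`, so it satisfies every equation valid in `K`.
  ... | no x≰y  = separatePair S.D (λ _ K⊆E → K⊆E S.D∈K) S.D-enumerable S.homomorphism S.separates
                    (separatingImage ps)
    where module S = Separation em K K⊆Conservative Σ K≐ A A∈V B x y x≰y

  private
    -- Members of `B` are arbitrary elements with membership proofs; the entries of the list provide
    -- finitely many representatives up to `≈`.
    occurrence : Fin (length B) → Member A B
    occurrence i = lookup B i , ∈ₛ-lookup A.setoid B i

    occurrences : List (Member A B)
    occurrences = map occurrence (allFin (length B))

    pairs : List (Member A B × Member A B)
    pairs = cartesianProductWith _,_ occurrences occurrences

  module Embedding (image : SeparatingImage pairs) where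
    open SeparatingImage image

    private
      module D = Properties D

    -- Both members are replaced by the entries at their positions, a pair among `pairs`, and
    -- `to-cong` carries the inequality over.
    to-reflects-≤ : ∀ x y → to x D.≤ to y → proj₁ x A.≤ proj₁ y
    to-reflects-≤ x@(_ , x∈) y@(_ , y∈) hx≤hy = A.≤-resp-≈ (A.≈.sym x≈) (A.≈.sym y≈)
      (reflects (∈-cartesianProductWith⁺ _,_ (∈-map⁺ occurrence (∈-allFin (Any.index x∈)))
                                             (∈-map⁺ occurrence (∈-allFin (Any.index y∈))))
        (D.≤-resp-≈ (to-cong x (occurrence (Any.index x∈)) x≈)
                    (to-cong y (occurrence (Any.index y∈)) y≈) hx≤hy))
      where
      x≈ = Anyₚ.lookup-index x∈
      y≈ = Anyₚ.lookup-index y∈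

    finiteEmbedding : ∃ λ (D : ResiduatedLattice c ℓ) →
                      VarietyGeneratedBy K D × Finite D × PartialSubalgebraEmbedding A B D
    finiteEmbedding = D , D∈V , enumerable⇒finite (resize c em) D D-enumerable , record
      { injection = record
        { to        = to
        ; cong      = λ {x} {y} → to-cong x y
        ; injective = λ {x} {y} hx≈hy → A.≤-antisym
            (to-reflects-≤ x y (D.≤-reflexive hx≈hy)) (to-reflects-≤ y x (D.≤-reflexive˘ hx≈hy))
        }
      ; preserves-operation = preserves-operation
      ; preserves-e         = preserves-e
      }

  finiteEmbedding : ∃ λ (D : ResiduatedLattice c ℓ) →
                    VarietyGeneratedBy K D × Finite D × PartialSubalgebraEmbedding A B D
  finiteEmbedding = Embedding.finiteEmbedding (separatingImage pairs)

theorem5p1 : ∀ {c ℓ k p : Level} → ExcludedMiddle (c ⊔ ℓ) →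
    (K : Pred (ResiduatedLattice c ℓ) k) → K ⊆ Conservative →
    (Σ : Pred PositiveFormula p) → DefinedRelativeToIdempotentBy K Σ →
    FiniteEmbeddabilityProperty (VarietyGeneratedBy K)
theorem5p1 em K K⊆Conservative Σ K≐ A A∈V B =
  finiteEmbedding em K K⊆Conservative Σ K≐ A A∈V B
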